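{- Let $d\ge1$, let $\mathbf{x}=(x_1,\dots,x_d)$ with each $x_i$ a positive integer, and let $\mathbf{n}=(n_1,\dots,n_d)\in\mathbb{N}^d$. Let $\boldsymbol{Z}=\{z_{\mathbf{k}}:\mathbf{k}\preceq\mathbf{n}\}\subset\mathbb{N}^d$ with $0\le z_{\mathbf{k},i}<x_i$ for all $i$, and such that $z_{\mathbf{k},i}\ge z_{\mathbf{k}',i}$ whenever $\mathbf{k}\preceq\mathbf{k}'\preceq\mathbf{n}$. Define $\boldsymbol{U}=\{u_{\mathbf{k}}:\mathbf{k}\preceq\mathbf{n}\}$ by $u_{\mathbf{k},i}=x_i-z_{\mathbf{k},i}$, and $-\boldsymbol{U}=\{ -u_{\mathbf{k}}\}$. Then $$\Big|\bigcup_{P:O\to A}\mathcal{I}_{\mathbf{n}}(P;\boldsymbol{U})\Big|=\frac{1}{\mathbf{n}!}\,\tilde g_{\mathbf{n}}(\mathbf{x};\boldsymbol{Z})=\frac{1}{\mathbf{n}!}\,\tilde g_{\mathbf{n}}((0,\dots,0);-\boldsymbol{U}),$$ where $P$ ranges over all lattice paths from $O=(0,\dots,0)$ to $A=(n_1,\dots,n_d)$ using unit steps $\mathbf{e}_1,\dots,\mathbf{e}_d$.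
   Context: For $\mathbf{k},\mathbf{n}\in\mathbb{N}^d$, $\mathbf{k}\preceq\mathbf{n}$ means $k_i\le n_i$ for all $i$; $\mathbf{n}!=n_1!\cdots n_d!$; $v_{i}$ or $v_{\mathbf{k},i}$ denotes the $i$-th coordinate of a vector; $\mathbf{e}_i$ is the $i$-th standard unit vector. Multivariate difference Gončarov polynomials (over $\mathbb{Q}$): $\Delta_{x_i}p=p(x_1,\dots,x_d)-p(x_1,\dots,x_i-1,\dots,x_d)$; for a node set $\boldsymbol{W}=\{w_{\mathbf{k}}\}$, $\tilde g_{\mathbf{n}}(\mathbf{x};\boldsymbol{W})$ is the unique polynomial of degree at most $n_i$ in $x_i$ for each $i$ such that $\Delta_{x_1}^{k_1}\cdots\Delta_{x_d}^{k_d}\tilde g_{\mathbf{n}}$ evaluated at $w_{\mathbf{k}}$ equals $\mathbf{n}!\,\delta_{\mathbf{k},\mathbf{n}}$ for all $\mathbf{k}\preceq\mathbf{n}$. Combinatorics: $\mathcal{I}(\mathbf{n})$ is the set of $d$-tuples $(\boldsymbol{a}^{(1)},\dots,\boldsymbol{a}^{(d)})$ of non-decreasing integer sequences, $\boldsymbol{a}^{(i)}=(a^{(i)}_0,\dots,a^{(i)}_{n_i-1})$, with $0\le a^{(i)}_j<x_i$. For a lattice path $P=\ell_1\cdots\ell_{n_1+\cdots+n_d}$ from $O$ to $A$ with steps in $\{\mathbf{e}_1,\dots,\mathbf{e}_d\}$, the tuple is bounded by $P$ with respect to $\boldsymbol{U}$ if for every $r$: whenever $\ell_r$ is an $\mathbf{e}_i$-step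 from $\mathbf{k}$ to $\mathbf{k}+\mathbf{e}_i$, then $a^{(i)}_{k_i}<u_{\mathbf{k},i}$. $\mathcal{I}_{\mathbf{n}}(P;\boldsymbol{U})$ is the set of tuples in $\mathcal{I}(\mathbf{n})$ bounded by $P$ with respect to $\boldsymbol{U}$. -}

module Defs where

open import Data.Nat as ℕ using (ℕ; zero; suc; _≤_; _<_; _∸_; _!)
open import Data.Nat.Properties using (≤-totalOrder)

open import Data.Integer using (+_)
open import Data.Rational using (ℚ; _/_; 0ℚ; 1ℚ) renaming (_+_ to _+ℚ_; _*_ to _*ℚ_; _-_ to _-ℚ_)
open import Data.Fin as Fin using (Fin)
open import Data.Vec as Vec using (Vec; lookup; updateAt; replicate)
open import Data.List as List using (List; []; _∷_; length; filter; drop; head; allFin; upTo; concatMap; foldr)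
open import Data.List.Relation.Unary.Sorted.TotalOrder ≤-totalOrder using (Sorted)
open import Data.List.Relation.Unary.All using (All)
open import Data.List.Relation.Unary.Unique.Propositional using (Unique)
open import Data.List.Membership.Propositional using (_∈_)
open import Data.Maybe using (Maybe; just)
open import Data.Product using (Σ; ∃; ∃-syntax; _×_)
open import Data.Unit using (⊤)
open import Function using (_∘_; _⇔_)
open import Relation.Nullary using (¬_)
open import Relation.Binary.PropositionalEquality using (_≡_)

_⪯_ : ∀ {d} → Vec ℕ d → Vec ℕ d → Set
k ⪯ n = ∀ i → lookup k i ≤ lookup n i

vfact : ∀ {d} → Vec ℕ d → ℕ
vfact n = Vec.foldr _ (λ m acc → (m !) ℕ.* acc) 1 n

step : ∀ {d} → Vec ℕ d → Fin d → Vec ℕ d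
step k i = updateAt k i suc

box : ∀ {d} → Vec ℕ d → List (Vec ℕ d)
box Vec.[] = Vec.[] ∷ []
box (m Vec.∷ n) = concatMap (λ j → List.map (j Vec.∷_) (box n)) (upTo (suc m))

ℕ→ℚ : ℕ → ℚ
ℕ→ℚ m = + m / 1

_^ℚ_ : ℚ → ℕ → ℚ
q ^ℚ zero = 1ℚ
q ^ℚ suc m = q *ℚ (q ^ℚ m)

sumℚ : List ℚ → ℚ
sumℚ = foldr _+ℚ_ 0ℚ

-- Polynomials in d variables over ℚ of degree at most n_i in x_i are
-- given by a coefficient function c (only the coefficients c k with
-- k ⪯ n are used):  p(y) = Σ_{k ⪯ n} c_k ∏_i y_i^{k_i}.

Coeffs : ℕ → Set
Coeffs d = Vec ℕ d → ℚ

monomial : ∀ {d} → Vec ℕ d → Vec ℚ d → ℚ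
monomial k y = Vec.foldr _ _*ℚ_ 1ℚ (Vec.zipWith _^ℚ_ y k)

evalPoly : ∀ {d} → Vec ℕ d → Coeffs d → Vec ℚ d → ℚ
evalPoly n c y = sumℚ (List.map (λ k → c k *ℚ monomial k y) (box n))

Fun : ℕ → Set
Fun d = Vec ℚ d → ℚ

Δ : ∀ {d} → Fin d → Fun d → Fun d
Δ i f y = f y -ℚ f (updateAt y i (λ t → t -ℚ 1ℚ))

Δpow : ∀ {d} → Fin d → ℕ → Fun d → Fun d
Δpow i zero f = f
Δpow i (suc m) f = Δ i (Δpow i m f)

Δmulti : ∀ {d} → Vec ℕ d → Fun d → Fun d
Δmulti {d} k f = foldr (λ i g → Δpow i (lookup k i) g) f (allFin d)

IsDiffGoncarov : ∀ {d} → (n : Vec ℕ d) → (W : Vec ℕ d → Vec ℚ d) → Coeffs d → Set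
IsDiffGoncarov n W c =
  ∀ k → k ⪯ n →
    (k ≡ n → Δmulti k (evalPoly n c) (W k) ≡ ℕ→ℚ (vfact n)) ×
    (¬ (k ≡ n) → Δmulti k (evalPoly n c) (W k) ≡ 0ℚ)

InI : ∀ {d} → Vec ℕ d → Vec ℕ d → Vec (List ℕ) d → Set
InI x n a = ∀ i → length (lookup a i) ≡ lookup n i
                × Sorted (lookup a i)
                × All (_< lookup x i) (lookup a i)

-- lattice path from O to A = n: a word in the steps e_i (encoded as i)
-- containing exactly n_i copies of e_i
IsPath : ∀ {d} → Vec ℕ d → List (Fin d) → Set
IsPath n P = ∀ i → length (filter (Fin._≟ i) P) ≡ lookup n i

_at_≡_ : List ℕ → ℕ → ℕ → Set
l at j ≡ v = head (drop j l) ≡ just v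

BoundedFrom : ∀ {d} → Vec (List ℕ) d → (Vec ℕ d → Vec ℕ d) → Vec ℕ d → List (Fin d) → Set
BoundedFrom a U k [] = ⊤
BoundedFrom a U k (i ∷ P) =
  (∃[ v ] (lookup a i at lookup k i ≡ v × v < lookup (U k) i))
  × BoundedFrom a U (step k i) P

InIP : ∀ {d} → Vec ℕ d → Vec ℕ d → (Vec ℕ d → Vec ℕ d) → List (Fin d) → Vec (List ℕ) d → Set
InIP {d} x n U P a = InI x n a × BoundedFrom a U (replicate d 0) P

InUnion : ∀ {d} → Vec ℕ d → Vec ℕ d → (Vec ℕ d → Vec ℕ d) → Vec (List ℕ) d → Set
InUnion x n U a = ∃[ P ] (IsPath n P × InIP x n U P a)

Enumerates : ∀ {d} → Vec ℕ d → Vec ℕ d → (Vec ℕ d → Vec ℕ d) → List (Vec (List ℕ) d) → Set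
Enumerates x n U L = Unique L × (∀ a → (a ∈ L) ⇔ InUnion x n U a)

Uof : ∀ {d} → Vec ℕ d → (Vec ℕ d → Vec ℕ d) → Vec ℕ d → Vec ℕ d
Uof x Z k = Vec.zipWith _∸_ x (Z k)

Zℚ : ∀ {d} → (Vec ℕ d → Vec ℕ d) → Vec ℕ d → Vec ℚ d
Zℚ Z k = Vec.map ℕ→ℚ (Z k)

negUℚ : ∀ {d} → (Vec ℕ d → Vec ℕ d) → Vec ℕ d → Vec ℚ d
negUℚ U k = Vec.map (Data.Rational.-_ ∘ ℕ→ℚ) (U k)

{-# OPTIONS --safe #-}

-- The union of the 𝓘_n(P;U) consists of the tuples a for which n can be reached from O by steps allowed
-- by a.  Since U is increasing, a step that is available remains available after any other step, so for
-- each tuple the greedy walk in the box of m ends at a point k that does not depend on the choices made.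
-- The tuple is then a tuple counted for k, followed in each coordinate i by an arbitrary sorted sequence
-- of length m_i - k_i in [u_{k,i}, x_i), an interval of size z_{k,i}.  With B_m the product over i of the
-- rising factorials y_i (y_i + 1) ⋯ (y_i + m_i - 1) / m_i!  and F(k) the number of tuples counted for k,
-- counting all of 𝓘(m) gives
--     B_m(x) = Σ_k B_{m-k}(z_k) F(k) = Σ_k (Δ^k B_m)(z_k) F(k),
-- and by linearity  p(x) = Σ_k (Δ^k p)(z_k) F(k)  for all p of degree at most n.  For the Gončarov
-- polynomial only the term k = n survives.  Translation by x turns the
-- nodes -U into Z and the origin into x, which gives the second identity.

module Submission where

open import Defs
open import Data.Empty using (⊥-elim)
open import Data.Fin using (Fin; zero; suc)
import Data.Fin as Fin
import Data.Fin.Properties as Finₚ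
import Data.Integer as ℤ
import Data.Integer.Properties as ℤₚ
open import Data.List using (List; []; _∷_; length; foldl; foldr; _++_; take; drop; filter;
  upTo; allFin; concatMap; cartesianProductWith)
import Data.List as List
import Data.List.Properties as Listₚ
open import Data.List.Membership.Propositional using (_∈_; find; lose)
import Data.List.Membership.Propositional.Properties as ∈ₚ
open import Data.List.Membership.Propositional.Properties.WithK using (unique∧set⇒bag)
open import Data.List.Relation.Binary.BagAndSetEquality using (∼bag⇒↭)
open import Data.List.Relation.Binary.Disjoint.Propositional using (Disjoint)
open import Data.List.Relation.Binary.Permutation.Propositional.Properties using (↭-length)
open import Data.List.Relation.Unary.All as All using (All; []; _∷_)
import Data.List.Relation.Unary.All.Properties as Allₚ
open import Data.List.Relation.Unary.AllPairs as AllPairs using (AllPairs; []; _∷_)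
import Data.List.Relation.Unary.AllPairs.Properties as AllPairsₚ
open import Data.List.Relation.Unary.Any using (here; there)
open import Data.List.Relation.Unary.Linked.Properties using (AllPairs⇒Linked; Linked⇒AllPairs)
open import Data.List.Relation.Unary.Unique.Propositional using (Unique)
import Data.List.Relation.Unary.Unique.Propositional.Properties as Uniqueₚ
open import Data.Maybe using (just; nothing)
open import Data.Nat using (ℕ; zero; suc; _≤_; _<_; z≤n; s≤s)
import Data.Nat as ℕ
import Data.Nat.Properties as ℕₚ
open import Data.List.Relation.Unary.Sorted.TotalOrder ℕₚ.≤-totalOrder using (Sorted)
open import Data.Product using (∃-syntax; _×_; _,_; proj₁; proj₂)
open import Data.Rational using (ℚ; 0ℚ; 1ℚ; _/_; _+_; _*_; _-_; -_)
import Data.Rational.Properties as ℚₚ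
open import Data.Rational.Solver using (module +-*-Solver)
import Data.Rational.Unnormalised as ℚᵘ
import Data.Rational.Unnormalised.Properties as ℚᵘₚ
open import Data.Sum using (inj₁; inj₂)
open import Data.Vec using (Vec; []; _∷_; lookup; replicate; zipWith; updateAt)
import Data.Vec as Vec
import Data.Vec.Properties as Vecₚ
open import Function using (_∘_; id; _⇔_; mk⇔; Equivalence)
open import Relation.Binary using (DecidableEquality)
open import Relation.Binary.PropositionalEquality
open import Relation.Nullary using (¬_; Dec; yes; no; _×-dec_)

open +-*-Solver using (solve; _:+_; _:*_; _:-_; :-_; _:=_; con)
open ≡-Reasoning

private
  variable
    d : ℕ

-- Backward differences of rising factorials

ℕ→ℚ-+ : ∀ a b → ℕ→ℚ (a ℕ.+ b) ≡ ℕ→ℚ a + ℕ→ℚ b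
ℕ→ℚ-+ a b = ℚₚ.toℚᵘ-injective
  (ℚᵘₚ.≃-trans (ℚₚ.toℚᵘ-fromℚᵘ (ℚᵘ.mkℚᵘ (ℤ.+ (a ℕ.+ b)) 0))
  (ℚᵘₚ.≃-sym (ℚᵘₚ.≃-trans (ℚₚ.toℚᵘ-homo-+ (ℕ→ℚ a) (ℕ→ℚ b))
  (ℚᵘₚ.≃-trans (ℚᵘₚ.+-cong (ℚₚ.toℚᵘ-fromℚᵘ (ℚᵘ.mkℚᵘ (ℤ.+ a) 0)) (ℚₚ.toℚᵘ-fromℚᵘ (ℚᵘ.mkℚᵘ (ℤ.+ b) 0)))
  (ℚᵘ.*≡* (cong (ℤ._* ℤ.+ 1) (cong₂ ℤ._+_ (ℤₚ.*-identityʳ (ℤ.+ a)) (ℤₚ.*-identityʳ (ℤ.+ b)))))))))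

ℕ→ℚ-* : ∀ a b → ℕ→ℚ (a ℕ.* b) ≡ ℕ→ℚ a * ℕ→ℚ b
ℕ→ℚ-* a b = ℚₚ.toℚᵘ-injective
  (ℚᵘₚ.≃-trans (ℚₚ.toℚᵘ-fromℚᵘ (ℚᵘ.mkℚᵘ (ℤ.+ (a ℕ.* b)) 0))
  (ℚᵘₚ.≃-sym (ℚᵘₚ.≃-trans (ℚₚ.toℚᵘ-homo-* (ℕ→ℚ a) (ℕ→ℚ b))
  (ℚᵘₚ.≃-trans (ℚᵘₚ.*-cong (ℚₚ.toℚᵘ-fromℚᵘ (ℚᵘ.mkℚᵘ (ℤ.+ a) 0)) (ℚₚ.toℚᵘ-fromℚᵘ (ℚᵘ.mkℚᵘ (ℤ.+ b) 0)))
  (ℚᵘ.*≡* (cong (ℤ._* ℤ.+ 1) (sym (ℤₚ.pos-* a b))))))))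

recip : ℕ → ℚ
recip m = ℤ.+ 1 / suc m

suc*recip : ∀ m → ℕ→ℚ (suc m) * recip m ≡ 1ℚ
suc*recip m = ℚₚ.toℚᵘ-injective
  (ℚᵘₚ.≃-trans (ℚₚ.toℚᵘ-homo-* (ℕ→ℚ (suc m)) (recip m))
  (ℚᵘₚ.≃-trans (ℚᵘₚ.*-cong (ℚₚ.toℚᵘ-fromℚᵘ (ℚᵘ.mkℚᵘ (ℤ.+ suc m) 0)) (ℚₚ.toℚᵘ-fromℚᵘ (ℚᵘ.mkℚᵘ (ℤ.+ 1) m)))
  (ℚᵘ.*≡* (trans (ℤₚ.*-identityʳ _)
    (trans (ℤₚ.*-comm (ℤ.+ suc m) (ℤ.+ 1)) (cong (λ j → ℤ.+ 1 ℤ.* ℤ.+ j) (sym (ℕₚ.*-identityˡ (suc m)))))))))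


-- The polynomial y(y+1)...(y+m-1)/m!, that is, the binomial coefficient C(y+m-1, m). With this
-- normalisation a backward difference lowers the index by one, and the value at a natural number
-- `w` counts the multisets of size `m` from `w` elements.
rising : ℕ → ℚ → ℚ
rising zero    y = 1ℚ
rising (suc m) y = rising m y * ((y + ℕ→ℚ m) * recip m)

suc-*-rising : ∀ m y → ℕ→ℚ (suc m) * rising (suc m) y ≡ rising m y * (y + ℕ→ℚ m)
suc-*-rising m y = begin
  ℕ→ℚ (suc m) * (rising m y * ((y + ℕ→ℚ m) * recip m))
    ≡⟨ solve 4 (λ s b c r → s :* (b :* (c :* r)) := (s :* r) :* (b :* c)) refl
         (ℕ→ℚ (suc m)) (rising m y) (y + ℕ→ℚ m) (recip m) ⟩
  (ℕ→ℚ (suc m) * recip m) * (rising m y * (y + ℕ→ℚ m))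
    ≡⟨ cong (_* (rising m y * (y + ℕ→ℚ m))) (suc*recip m) ⟩
  1ℚ * (rising m y * (y + ℕ→ℚ m))
    ≡⟨ ℚₚ.*-identityˡ _ ⟩
  rising m y * (y + ℕ→ℚ m) ∎

ℕ→ℚ-suc : ∀ m → ℕ→ℚ (suc m) ≡ 1ℚ + ℕ→ℚ m
ℕ→ℚ-suc = ℕ→ℚ-+ 1

suc-cancelˡ : ∀ m {p q} → ℕ→ℚ (suc m) * p ≡ ℕ→ℚ (suc m) * q → p ≡ q
suc-cancelˡ m {p} {q} eq = trans (sym (undo p)) (trans (cong (recip m *_) eq) (undo q))
  where
  undo : ∀ t → recip m * (ℕ→ℚ (suc m) * t) ≡ t
  undo t = begin
    recip m * (ℕ→ℚ (suc m) * t) ≡⟨ solve 3 (λ r s u → r :* (s :* u) := (s :* r) :* u) refl (recip m) (ℕ→ℚ (suc m)) t ⟩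
    (ℕ→ℚ (suc m) * recip m) * t ≡⟨ cong (_* t) (suc*recip m) ⟩
    1ℚ * t                      ≡⟨ ℚₚ.*-identityˡ t ⟩
    t ∎

-- Multiplied by m!, both sides are (y-1)y...(y+m-1). Since `rising` attaches its factors at the
-- upper end, splitting off the lowest one takes an induction.
suc-*-rising-pred : ∀ m y → ℕ→ℚ (suc m) * rising (suc m) (y - 1ℚ) ≡ (y - 1ℚ) * rising m y
suc-*-rising-pred zero    y = begin
  1ℚ * (1ℚ * ((y - 1ℚ + 0ℚ) * 1ℚ))
    ≡⟨ solve 1 (λ y → con 1ℚ :* (con 1ℚ :* ((y :- con 1ℚ :+ con 0ℚ) :* con 1ℚ)) := (y :- con 1ℚ) :* con 1ℚ) refl y ⟩
  (y - 1ℚ) * 1ℚ ∎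
suc-*-rising-pred (suc m) y = begin
  ℕ→ℚ (suc (suc m)) * rising (suc (suc m)) (y - 1ℚ)
    ≡⟨ suc-*-rising (suc m) (y - 1ℚ) ⟩
  rising (suc m) (y - 1ℚ) * (y - 1ℚ + ℕ→ℚ (suc m))
    ≡⟨ cong (λ t → rising (suc m) (y - 1ℚ) * (y - 1ℚ + t)) (ℕ→ℚ-suc m) ⟩
  rising (suc m) (y - 1ℚ) * (y - 1ℚ + (1ℚ + ℕ→ℚ m))
    ≡⟨ solve 3 (λ b y u → b :* (y :- con 1ℚ :+ (con 1ℚ :+ u)) := (y :+ u) :* b) refl
         (rising (suc m) (y - 1ℚ)) y (ℕ→ℚ m) ⟩
  (y + ℕ→ℚ m) * rising (suc m) (y - 1ℚ)
    -- The factor `suc m` is put on both sides so that the induction hypothesis applies.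
    ≡⟨ suc-cancelˡ m (begin
         ℕ→ℚ (suc m) * ((y + ℕ→ℚ m) * rising (suc m) (y - 1ℚ))
           ≡⟨ solve 3 (λ s c b → s :* (c :* b) := c :* (s :* b)) refl
                (ℕ→ℚ (suc m)) (y + ℕ→ℚ m) (rising (suc m) (y - 1ℚ)) ⟩
         (y + ℕ→ℚ m) * (ℕ→ℚ (suc m) * rising (suc m) (y - 1ℚ))
           ≡⟨ cong ((y + ℕ→ℚ m) *_) (suc-*-rising-pred m y) ⟩
         (y + ℕ→ℚ m) * ((y - 1ℚ) * rising m y)
           ≡⟨ solve 3 (λ c e b → c :* (e :* b) := e :* (b :* c)) refl
                (y + ℕ→ℚ m) (y - 1ℚ) (rising m y) ⟩
         (y - 1ℚ) * (rising m y * (y + ℕ→ℚ m))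
           ≡⟨ cong ((y - 1ℚ) *_) (suc-*-rising m y) ⟨
         (y - 1ℚ) * (ℕ→ℚ (suc m) * rising (suc m) y)
           ≡⟨ solve 3 (λ e s b → e :* (s :* b) := s :* (e :* b)) refl
                (y - 1ℚ) (ℕ→ℚ (suc m)) (rising (suc m) y) ⟩
         ℕ→ℚ (suc m) * ((y - 1ℚ) * rising (suc m) y) ∎) ⟩
  (y - 1ℚ) * rising (suc m) y ∎

-- After multiplication by `suc m` both terms contain `rising m y`, and the remaining factors differ
-- by (y+m)-(y-1) = m+1.
rising-Δ : ∀ m y → rising (suc m) y - rising (suc m) (y - 1ℚ) ≡ rising m y
rising-Δ m y = suc-cancelˡ m (begin
  ℕ→ℚ (suc m) * (rising (suc m) y - rising (suc m) (y - 1ℚ))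
    ≡⟨ solve 3 (λ s a b → s :* (a :- b) := s :* a :- s :* b) refl
         (ℕ→ℚ (suc m)) (rising (suc m) y) (rising (suc m) (y - 1ℚ)) ⟩
  ℕ→ℚ (suc m) * rising (suc m) y - ℕ→ℚ (suc m) * rising (suc m) (y - 1ℚ)
    ≡⟨ cong₂ _-_ (suc-*-rising m y) (suc-*-rising-pred m y) ⟩
  rising m y * (y + ℕ→ℚ m) - (y - 1ℚ) * rising m y
    ≡⟨ solve 3 (λ b y u → b :* (y :+ u) :- (y :- con 1ℚ) :* b := (con 1ℚ :+ u) :* b) refl
         (rising m y) y (ℕ→ℚ m) ⟩
  (1ℚ + ℕ→ℚ m) * rising m y
    ≡⟨ cong (_* rising m y) (ℕ→ℚ-suc m) ⟨
  ℕ→ℚ (suc m) * rising m y ∎)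

rising-0 : ∀ m → rising (suc m) 0ℚ ≡ 0ℚ
rising-0 zero    = refl
rising-0 (suc m) = trans (cong (_* ((0ℚ + ℕ→ℚ (suc m)) * recip (suc m))) (rising-0 m))
  (ℚₚ.*-zeroˡ ((0ℚ + ℕ→ℚ (suc m)) * recip (suc m)))

-- The `k`-th backward difference of `rising m`. Recursion on both indices gives zero for k > m,
-- where truncated subtraction of the indices would give the constant one.
risingΔ : ℕ → ℕ → ℚ → ℚ
risingΔ zero    m       y = rising m y
risingΔ (suc k) zero    y = 0ℚ
risingΔ (suc k) (suc m) y = risingΔ k m y

risingΔ-Δ : ∀ k m y → risingΔ k m y - risingΔ k m (y - 1ℚ) ≡ risingΔ (suc k) m y
risingΔ-Δ zero    zero    y = refl
risingΔ-Δ zero    (suc m) y = rising-Δ m y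
risingΔ-Δ (suc k) zero    y = refl
risingΔ-Δ (suc k) (suc m) y = risingΔ-Δ k m y

risingΔ-diag : ∀ m y → risingΔ m m y ≡ 1ℚ
risingΔ-diag zero    y = refl
risingΔ-diag (suc m) y = risingΔ-diag m y

risingΔ-≰ : ∀ k m y → ¬ k ≤ m → risingΔ k m y ≡ 0ℚ
risingΔ-≰ zero    m       y k≰m = ⊥-elim (k≰m z≤n)
risingΔ-≰ (suc k) zero    y k≰m = refl
risingΔ-≰ (suc k) (suc m) y k≰m = risingΔ-≰ k m y (k≰m ∘ s≤s)

-- Linear spans

-- Each constructor carries a pointwise equation, so membership is stable under pointwise equality
-- without function extensionality. Statements linear in the function can be proved by induction on
-- the derivation.
data Span {K X : Set} (P : K → Set) (φ : K → X → ℚ) : (X → ℚ) → Set where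
  null : ∀ {f} → (∀ x → f x ≡ 0ℚ) → Span P φ f
  gen  : ∀ {k f} → P k → (∀ x → f x ≡ φ k x) → Span P φ f
  lin  : ∀ {f g h} c → Span P φ f → Span P φ g → (∀ x → h x ≡ f x + c * g x) → Span P φ h

module _ {K X : Set} {P : K → Set} {φ : K → X → ℚ} where

  span-ext : ∀ {f h} → Span P φ f → (∀ x → h x ≡ f x) → Span P φ h
  span-ext (null f≗0)     h≗f = null (λ x → trans (h≗f x) (f≗0 x))
  span-ext (gen p f≗φ)    h≗f = gen p (λ x → trans (h≗f x) (f≗φ x))
  span-ext (lin c s t eq) h≗f = lin c s t (λ x → trans (h≗f x) (eq x))

  span-+* : ∀ a b {f g} → Span P φ f → Span P φ g → Span P φ (λ x → a * f x + b * g x)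
  span-+* a b {f} {g} s t =
    lin b (lin {f = λ _ → 0ℚ} {h = λ x → a * f x} a (null (λ _ → refl)) s (λ x → sym (ℚₚ.+-identityˡ (a * f x)))) t
      (λ x → refl)

  span-sum : ∀ (c : K → ℚ) L → All P L → Span P φ (λ x → sumℚ (List.map (λ k → c k * φ k x) L))
  span-sum c []      []       = null (λ x → refl)
  span-sum c (k ∷ L) (p ∷ ps) = lin (c k) (span-sum c L ps) (gen p (λ x → refl)) (λ x → ℚₚ.+-comm (c k * φ k x) _)

module _ {K X L Y : Set} {P : K → Set} {φ : K → X → ℚ} {Q : L → Set} {ψ : L → Y → ℚ} where

  -- Composition with `σ` followed by multiplication by `u` is linear, so it suffices to treat the
  -- generators.
  span-map : (u : Y → ℚ) (σ : Y → X) →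
             (∀ k → P k → Span Q ψ (λ y → u y * φ k (σ y))) →
             ∀ {f} → Span P φ f → Span Q ψ (λ y → u y * f (σ y))
  span-map u σ gens (null f≗0)    = null (λ y → trans (cong (u y *_) (f≗0 (σ y))) (ℚₚ.*-zeroʳ (u y)))
  span-map u σ gens (gen p f≗φ)   = span-ext (gens _ p) (λ y → cong (u y *_) (f≗φ (σ y)))
  span-map u σ gens (lin {f} {g} c s t eq) =
    lin c (span-map u σ gens s) (span-map u σ gens t)
      (λ y → trans (cong (u y *_) (eq (σ y)))
        (solve 4 (λ u f c g → u :* (f :+ c :* g) := u :* f :+ c :* (u :* g)) refl (u y) (f (σ y)) c (g (σ y))))

module _ {K : Set} where

  sum-single : (g : K → ℚ) → ∀ {L} → Unique L → ∀ {k} → k ∈ L → (∀ k′ → k′ ∈ L → ¬ k′ ≡ k → g k′ ≡ 0ℚ) →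
               sumℚ (List.map g L) ≡ g k
  sum-single g {k ∷ L} (k∉L ∷ uL) (here refl) zeros =
    trans (cong (g k +_) (sum-zero L (λ k′ k′∈L → zeros k′ (there k′∈L) (λ eq → All.lookup k∉L k′∈L (sym eq)))))
          (ℚₚ.+-identityʳ (g k))
    where
    sum-zero : ∀ L → (∀ k′ → k′ ∈ L → g k′ ≡ 0ℚ) → sumℚ (List.map g L) ≡ 0ℚ
    sum-zero []      zs = refl
    sum-zero (k ∷ L) zs = trans (cong₂ _+_ (zs k (here refl)) (sum-zero L (λ k′ m → zs k′ (there m)))) refl
  sum-single g {k₀ ∷ L} (k₀∉L ∷ uL) (there k∈L) zeros =
    trans (cong₂ _+_ (zeros k₀ (here refl) (All.lookup k₀∉L k∈L))
                     (sum-single g uL k∈L (λ k′ m → zeros k′ (there m))))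
          (ℚₚ.+-identityˡ _)

module _ {K : Set} (_≟_ : DecidableEquality K) where

  δ : K → ℚ → K → ℚ
  δ k a k′ with k′ ≟ k
  ... | yes _ = a
  ... | no  _ = 0ℚ

  δ-≡ : ∀ k a {k′} → k′ ≡ k → δ k a k′ ≡ a
  δ-≡ k a {k′} eq with k′ ≟ k
  ... | yes _  = refl
  ... | no neq = ⊥-elim (neq eq)

  δ-≢ : ∀ k a {k′} → ¬ k′ ≡ k → δ k a k′ ≡ 0ℚ
  δ-≢ k a {k′} neq with k′ ≟ k
  ... | yes eq = ⊥-elim (neq eq)
  ... | no _   = refl

module _ {K X : Set} {P : K → Set} {φ : K → X → ℚ} (_≟_ : DecidableEquality K) where

  -- A generator contributes a Kronecker delta, which the sum picks up exactly once because `L` has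
  -- no repetitions; linear combinations act on the coefficients.
  span-coefficients : ∀ {L} → Unique L → (∀ k → P k → k ∈ L) → ∀ {f} → Span P φ f →
                      ∃[ c ] ∀ x → sumℚ (List.map (λ k → c k * φ k x) L) ≡ f x
  span-coefficients {L} uL P⇒∈ (null f≗0) =
    (λ _ → 0ℚ) , λ x → trans (zeros x L) (sym (f≗0 x))
    where
    zeros : ∀ x L → sumℚ (List.map (λ k → 0ℚ * φ k x) L) ≡ 0ℚ
    zeros x []      = refl
    zeros x (k ∷ L) = trans (cong₂ _+_ (ℚₚ.*-zeroˡ (φ k x)) (zeros x L)) refl
  span-coefficients {L} uL P⇒∈ (gen {k} p f≗φ) =
    δ _≟_ k 1ℚ , λ x → begin
      sumℚ (List.map (λ k′ → δ _≟_ k 1ℚ k′ * φ k′ x) L)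
        ≡⟨ sum-single (λ k′ → δ _≟_ k 1ℚ k′ * φ k′ x) uL (P⇒∈ k p)
             (λ k′ _ k′≢k → trans (cong (_* φ k′ x) (δ-≢ _≟_ k 1ℚ k′≢k)) (ℚₚ.*-zeroˡ (φ k′ x))) ⟩
      δ _≟_ k 1ℚ k * φ k x ≡⟨ cong (_* φ k x) (δ-≡ _≟_ k 1ℚ refl) ⟩
      1ℚ * φ k x       ≡⟨ ℚₚ.*-identityˡ (φ k x) ⟩
      φ k x            ≡⟨ f≗φ x ⟨
      _ ∎
  span-coefficients {L} uL P⇒∈ (lin {f} {g} a s t eq)
    with c , c≗f ← span-coefficients uL P⇒∈ s | c′ , c′≗g ← span-coefficients uL P⇒∈ t =
    (λ k → c k + a * c′ k) , λ x → trans (sums x L) (trans (cong₂ (λ p q → p + a * q) (c≗f x) (c′≗g x)) (sym (eq x)))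
    where
    sums : ∀ x L → sumℚ (List.map (λ k → (c k + a * c′ k) * φ k x) L)
                 ≡ sumℚ (List.map (λ k → c k * φ k x) L) + a * sumℚ (List.map (λ k → c′ k * φ k x) L)
    sums x []      = sym (trans (ℚₚ.+-identityˡ (a * 0ℚ)) (ℚₚ.*-zeroʳ a))
    sums x (k ∷ L) = trans (cong ((c k + a * c′ k) * φ k x +_) (sums x L))
      (solve 6 (λ c a c′ p s t → (c :+ a :* c′) :* p :+ (s :+ a :* t) := (c :* p :+ s) :+ a :* (c′ :* p :+ t)) refl
        (c k) a (c′ k) (φ k x) _ _)

-- Products over the coordinates and change of basis

tensor : (ℕ → ℚ → ℚ) → Vec ℕ d → Vec ℚ d → ℚ
tensor φ []       []       = 1ℚ
tensor φ (k ∷ ks) (y ∷ ys) = φ k y * tensor φ ks ys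

monomial≡tensor : ∀ (k : Vec ℕ d) y → monomial k y ≡ tensor (λ j t → t ^ℚ j) k y
monomial≡tensor []       []       = refl
monomial≡tensor (k ∷ ks) (y ∷ ys) = cong (y ^ℚ k *_) (monomial≡tensor ks ys)

-- A product of univariate expansions is an expansion in products. The head factor is expanded with
-- the tail product as multiplier, and then the tail product with each head generator as multiplier.
-- The shift `s` makes translated polynomials available.
span-tensor : ∀ {φ ψ} → (∀ m k s → k ≤ m → Span (_≤ m) ψ (λ y → φ k (y - s))) →
              ∀ (n k : Vec ℕ d) s → k ⪯ n → Span (_⪯ n) (tensor ψ) (λ y → tensor φ k (zipWith _-_ y s))
span-tensor base []      []       []       k⪯n = gen {k = []} (λ ()) (λ { [] → refl })
span-tensor {φ = φ} {ψ} base (m ∷ ms) (k ∷ ks) (s ∷ ss) k⪯n =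
  span-ext
    (span-map (λ y → tensor φ ks (zipWith _-_ (Vec.tail y) ss)) Vec.head
      (λ l l≤m → span-ext
        (span-map (ψ l ∘ Vec.head) Vec.tail
          (λ ls ls⪯ms → gen {k = l ∷ ls} (λ { zero → l≤m ; (suc i) → ls⪯ms i }) (λ { (y ∷ ys) → refl }))
          (span-tensor base ms ks ss (k⪯n ∘ suc)))
        (λ y → ℚₚ.*-comm _ (ψ l (Vec.head y))))
      (base m k s (k⪯n zero)))
    (λ { (y ∷ ys) → ℚₚ.*-comm (φ k (y - s)) _ })

span-weaken : ∀ {m n} {φ : ℕ → ℚ → ℚ} → m ≤ n → ∀ {f} → Span (_≤ m) φ f → Span (_≤ n) φ f
span-weaken m≤n (null f≗0)     = null f≗0
span-weaken m≤n (gen p f≗φ)    = gen (ℕₚ.≤-trans p m≤n) f≗φ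
span-weaken m≤n (lin c s t eq) = lin c (span-weaken m≤n s) (span-weaken m≤n t) eq

-- Multiplication by y-s raises the index by at most one, since (y-s) `rising l y` = (l+1)
-- `rising (suc l) y` - (l+s) `rising l y`.
pow-rising : ∀ m k s → k ≤ m → Span (_≤ m) rising (λ y → (y - s) ^ℚ k)
pow-rising m k s k≤m = span-weaken k≤m (go k)
  where
  go : ∀ k → Span (_≤ k) rising (λ y → (y - s) ^ℚ k)
  go zero    = gen {k = 0} z≤n (λ y → refl)
  go (suc k) = span-map (_- s) id (λ l l≤k → span-ext
    (span-+* (ℕ→ℚ (suc l)) (- (ℕ→ℚ l + s))
      (gen {k = suc l} (s≤s l≤k) (λ _ → refl)) (gen {k = l} (ℕₚ.m≤n⇒m≤1+n l≤k) (λ _ → refl)))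
    (λ y → sym (begin
      ℕ→ℚ (suc l) * rising (suc l) y + (- (ℕ→ℚ l + s)) * rising l y
        ≡⟨ cong (_+ (- (ℕ→ℚ l + s)) * rising l y) (suc-*-rising l y) ⟩
      rising l y * (y + ℕ→ℚ l) + (- (ℕ→ℚ l + s)) * rising l y
        ≡⟨ solve 4 (λ b y l s → b :* (y :+ l) :+ (:- (l :+ s)) :* b := (y :- s) :* b) refl (rising l y) y (ℕ→ℚ l) s ⟩
      (y - s) * rising l y ∎)))
    (go k)

-- Each new factor of `rising` is affine in `y`, so it sends the power of exponent `l` to a
-- combination of the powers `l` and `suc l`.
rising-pow : ∀ m k s → k ≤ m → Span (_≤ m) (λ j t → t ^ℚ j) (λ y → rising k (y - s))
rising-pow m k s k≤m = span-weaken k≤m (go k)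
  where
  go : ∀ k → Span (_≤ k) (λ j t → t ^ℚ j) (λ y → rising k (y - s))
  go zero    = gen {k = 0} z≤n (λ y → refl)
  go (suc k) = span-ext
    (span-map (λ y → (y - s + ℕ→ℚ k) * recip k) id (λ l l≤k → span-ext
      (span-+* (recip k) ((ℕ→ℚ k - s) * recip k)
      (gen {k = suc l} (s≤s l≤k) (λ _ → refl)) (gen {k = l} (ℕₚ.m≤n⇒m≤1+n l≤k) (λ _ → refl)))
      (λ y → solve 5 (λ y s u r p → (y :- s :+ u) :* r :* p := r :* (y :* p) :+ (u :- s) :* r :* p) refl
               y s (ℕ→ℚ k) (recip k) (y ^ℚ l)))
    (go k))
    (λ y → ℚₚ.*-comm (rising k (y - s)) _)

-- Iterated differences in several variables

tensorΔ : Vec ℕ d → Vec ℕ d → Vec ℚ d → ℚ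
tensorΔ []       []       []       = 1ℚ
tensorΔ (k ∷ ks) (m ∷ ms) (y ∷ ys) = risingΔ k m y * tensorΔ ks ms ys

tensorΔ-diag : ∀ (m : Vec ℕ d) y → tensorΔ m m y ≡ 1ℚ
tensorΔ-diag []       []       = refl
tensorΔ-diag (m ∷ ms) (y ∷ ys) = cong₂ _*_ (risingΔ-diag m y) (tensorΔ-diag ms ys)

tensorΔ-⋠ : ∀ (k m : Vec ℕ d) y → ¬ k ⪯ m → tensorΔ k m y ≡ 0ℚ
tensorΔ-⋠ []       []       []       k⋠m = ⊥-elim (k⋠m (λ ()))
tensorΔ-⋠ (k ∷ ks) (m ∷ ms) (y ∷ ys) k⋠m with k ℕ.≤? m
... | no k≰m  = trans (cong (_* tensorΔ ks ms ys) (risingΔ-≰ k m y k≰m)) (ℚₚ.*-zeroˡ (tensorΔ ks ms ys))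
... | yes k≤m = trans (cong (risingΔ k m y *_)
                        (tensorΔ-⋠ ks ms ys (λ ks⪯ms → k⋠m (λ { zero → k≤m ; (suc i) → ks⪯ms i }))))
                      (ℚₚ.*-zeroʳ (risingΔ k m y))

module _ (σ : Vec ℚ d → Vec ℚ d)
         (σ-pred : ∀ y i → σ (updateAt y i (_- 1ℚ)) ≡ updateAt (σ y) i (_- 1ℚ))
         (a b : ℚ) where

  private
    -- One relation serves three purposes: linearity, pointwise congruence (with `b` zero), and
    -- translation invariance (with `σ` a shift).
    Combination : Fun d → Fun d → Fun d → Set
    Combination f g h = ∀ y → h y ≡ a * f (σ y) + b * g (σ y)

  Δ-lin : ∀ i {f g h} → Combination f g h → Combination (Δ i f) (Δ i g) (Δ i h)
  Δ-lin i {f} {g} {h} eq y = trans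
    (cong₂ _-_ (eq y) (trans (eq _) (cong (λ z → a * f z + b * g z) (σ-pred y i))))
    (solve 6 (λ a b f g f′ g′ → (a :* f :+ b :* g) :- (a :* f′ :+ b :* g′) := a :* (f :- f′) :+ b :* (g :- g′)) refl
      a b (f (σ y)) (g (σ y)) (f (updateAt (σ y) i (_- 1ℚ))) (g (updateAt (σ y) i (_- 1ℚ))))

  Δpow-lin : ∀ i r {f g h} → Combination f g h → Combination (Δpow i r f) (Δpow i r g) (Δpow i r h)
  Δpow-lin i zero    eq = eq
  Δpow-lin i (suc r) {f} {g} eq = Δ-lin i {Δpow i r f} {Δpow i r g} (Δpow-lin i r {f} {g} eq)

  Δmulti-lin : ∀ k {f g h} → Combination f g h → Combination (Δmulti k f) (Δmulti k g) (Δmulti k h)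
  Δmulti-lin k {f} {g} {h} eq = go (allFin d)
    where
    go : ∀ L → Combination (foldr (λ i → Δpow i (lookup k i)) f L)
                           (foldr (λ i → Δpow i (lookup k i)) g L)
                           (foldr (λ i → Δpow i (lookup k i)) h L)
    go []      = eq
    go (i ∷ L) = Δpow-lin i (lookup k i)
      {foldr (λ j → Δpow j (lookup k j)) f L} {foldr (λ j → Δpow j (lookup k j)) g L} (go L)

combination-0ʳ : ∀ p q → 1ℚ * p + 0ℚ * q ≡ p
combination-0ʳ = solve 2 (λ p q → con 1ℚ :* p :+ con 0ℚ :* q := p) refl

Δpow-cong : ∀ i r {f h : Fun d} → (∀ y → h y ≡ f y) → ∀ y → Δpow i r h y ≡ Δpow i r f y
Δpow-cong i r {f} eq y = trans
  (Δpow-lin id (λ _ _ → refl) 1ℚ 0ℚ i r {f} {f} (λ z → trans (eq z) (sym (combination-0ʳ (f z) (f z)))) y)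
  (combination-0ʳ (Δpow i r f y) (Δpow i r f y))

Δmulti-cong : ∀ k {f h : Fun d} → (∀ y → h y ≡ f y) → ∀ y → Δmulti k h y ≡ Δmulti k f y
Δmulti-cong k {f} eq y = trans
  (Δmulti-lin id (λ _ _ → refl) 1ℚ 0ℚ k {f} {f} (λ z → trans (eq z) (sym (combination-0ʳ (f z) (f z)))) y)
  (combination-0ʳ (Δmulti k f y) (Δmulti k f y))

Δmulti-+* : ∀ k c {f g h : Fun d} → (∀ y → h y ≡ f y + c * g y) → ∀ y → Δmulti k h y ≡ Δmulti k f y + c * Δmulti k g y
Δmulti-+* k c {f} {g} eq y = trans
  (Δmulti-lin id (λ _ _ → refl) 1ℚ c k {f} {g} (λ z → trans (eq z) (cong (_+ c * g z) (sym (ℚₚ.*-identityˡ (f z))))) y)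
  (cong (_+ c * Δmulti k g y) (ℚₚ.*-identityˡ (Δmulti k f y)))

Δmulti-* : ∀ k c {g h : Fun d} → (∀ y → h y ≡ c * g y) → ∀ y → Δmulti k h y ≡ c * Δmulti k g y
Δmulti-* k c {g} eq y = trans
  (Δmulti-lin id (λ _ _ → refl) 0ℚ c k {g} {g} (λ z → trans (eq z) (0* (g z) (g z))) y)
  (sym (0* (Δmulti k g y) (Δmulti k g y)))
  where
  0* : ∀ p q → c * q ≡ 0ℚ * p + c * q
  0* p q = solve 3 (λ c p q → c :* q := con 0ℚ :* p :+ c :* q) refl c p q

Δmulti-0 : ∀ k {f : Fun d} → (∀ y → f y ≡ 0ℚ) → ∀ y → Δmulti k f y ≡ 0ℚ
Δmulti-0 k {f} eq y = trans (Δmulti-* k 0ℚ {f} (λ z → trans (eq z) (sym (ℚₚ.*-zeroˡ (f z)))) y) (ℚₚ.*-zeroˡ (Δmulti k f y))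

shift-pred : ∀ (s y : Vec ℚ d) i → zipWith _-_ (updateAt y i (_- 1ℚ)) s ≡ updateAt (zipWith _-_ y s) i (_- 1ℚ)
shift-pred (s ∷ ss) (y ∷ ys) zero    = cong (_∷ _) (solve 2 (λ y s → y :- con 1ℚ :- s := y :- s :- con 1ℚ) refl y s)
shift-pred (s ∷ ss) (y ∷ ys) (suc i) = cong (_ ∷_) (shift-pred ss ys i)

Δmulti-shift : ∀ k s (f : Fun d) y → Δmulti k (λ z → f (zipWith _-_ z s)) y ≡ Δmulti k f (zipWith _-_ y s)
Δmulti-shift k s f y = trans
  (Δmulti-lin (λ z → zipWith _-_ z s) (shift-pred s) 1ℚ 0ℚ k {f} {f}
    (λ z → sym (combination-0ʳ (f (zipWith _-_ z s)) (f (zipWith _-_ z s)))) y)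
  (combination-0ʳ (Δmulti k f (zipWith _-_ y s)) (Δmulti k f (zipWith _-_ y s)))

-- The factor `g` does not involve the coordinate zero, so it passes through the differences as a
-- constant.
Δpow-zero-rising : ∀ k m {h : Fun (suc d)} {g : Fun d} → (∀ y ys → h (y ∷ ys) ≡ rising m y * g ys) →
                   ∀ y ys → Δpow zero k h (y ∷ ys) ≡ risingΔ k m y * g ys
Δpow-zero-rising zero    m eq y ys = eq y ys
Δpow-zero-rising (suc k) m {g = g} eq y ys = trans
  (cong₂ _-_ (Δpow-zero-rising k m {g = g} eq y ys) (Δpow-zero-rising k m {g = g} eq (y - 1ℚ) ys))
  (trans (solve 3 (λ a b g → a :* g :- b :* g := (a :- b) :* g) refl (risingΔ k m y) (risingΔ k m (y - 1ℚ)) (g ys))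
         (cong (_* g ys) (risingΔ-Δ k m y)))

Δpow-suc : ∀ i r (f : Fun (suc d)) y ys → Δpow (suc i) r f (y ∷ ys) ≡ Δpow i r (λ zs → f (y ∷ zs)) ys
Δpow-suc i zero    f y ys = refl
Δpow-suc i (suc r) f y ys = cong₂ _-_ (Δpow-suc i r f y ys) (Δpow-suc i r f y (updateAt ys i (_- 1ℚ)))

-- The list `allFin (suc d)` is `zero` followed by `List.tabulate suc`. Differences along the latter
-- keep the head `y` fixed, so they act on the slice of `f` at `y`.
Δmulti-∷ : ∀ k (ks : Vec ℕ d) (f : Fun (suc d)) y ys →
           foldr (λ i → Δpow i (lookup (k ∷ ks) i)) f (List.tabulate suc) (y ∷ ys) ≡ Δmulti ks (λ zs → f (y ∷ zs)) ys
Δmulti-∷ {d} k ks f y ys = trans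
  (cong (λ L → foldr (λ i → Δpow i (lookup (k ∷ ks) i)) f L (y ∷ ys)) (sym (Listₚ.map-tabulate id suc)))
  (go (allFin d) ys)
  where
  go : ∀ L ys → foldr (λ i → Δpow i (lookup (k ∷ ks) i)) f (List.map suc L) (y ∷ ys)
              ≡ foldr (λ i → Δpow i (lookup ks i)) (λ zs → f (y ∷ zs)) L ys
  go []      ys = refl
  go (i ∷ L) ys = trans (Δpow-suc i (lookup ks i) _ y ys) (Δpow-cong i (lookup ks i) (go L) ys)

-- The fold applies the differences in the later coordinates first, for which `rising m z` is a
-- constant factor; the differences in coordinate zero then act on that factor alone.
Δmulti-rising : ∀ (k m : Vec ℕ d) y → Δmulti k (tensor rising m) y ≡ tensorΔ k m y
Δmulti-rising []       []       []       = refl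
Δmulti-rising (k ∷ ks) (m ∷ ms) (y ∷ ys) = Δpow-zero-rising k m {g = tensorΔ ks ms}
  (λ z zs → trans (Δmulti-∷ k ks (tensor rising (m ∷ ms)) z zs)
    (trans (Δmulti-* ks (rising m z) {tensor rising ms} (λ _ → refl) zs)
           (cong (rising m z *_) (Δmulti-rising ks ms zs))))
  y ys

-- The triangular system is solved from the last node backwards: a correction by a multiple of
-- the basis polynomial of k leaves the conditions at all j with ¬ j ⪯ k unchanged.
interpolate : ∀ (n : Vec ℕ d) (W : Vec ℕ d → Vec ℚ d) (v : Vec ℕ d → ℚ) L →
              All (_⪯ n) L → AllPairs (λ k j → ¬ j ⪯ k) L →
              ∃[ f ] Span (_⪯ n) (tensor rising) f × (∀ k → k ∈ L → Δmulti k f (W k) ≡ v k)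
interpolate n W v []      []         []           = (λ _ → 0ℚ) , null (λ _ → refl) , λ _ ()
interpolate n W v (k ∷ L) (k⪯n ∷ ps) (later ∷ qs) with interpolate n W v L ps qs
... | f , f∈ , f-solves = (λ y → f y + c * tensor rising k y) , lin c f∈ (gen {k = k} k⪯n (λ _ → refl)) (λ _ → refl) , solves
  where
  -- The defect of `f` at the node of `k`. As the `k`-th difference of `tensor rising k` is the
  -- constant one, adding `c` times this product repairs the condition at `k`.
  c = v k - Δmulti k f (W k)
  Δh : ∀ j → Δmulti j (λ y → f y + c * tensor rising k y) (W j) ≡ Δmulti j f (W j) + c * tensorΔ j k (W j)
  Δh j = trans (Δmulti-+* j c {f} {tensor rising k} (λ _ → refl) (W j))
               (cong (λ t → Δmulti j f (W j) + c * t) (Δmulti-rising j k (W j)))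
  solves : ∀ j → j ∈ k ∷ L → Δmulti j (λ y → f y + c * tensor rising k y) (W j) ≡ v j
  solves j (here refl) = begin
    _                               ≡⟨ Δh k ⟩
    Δmulti k f (W k) + c * tensorΔ k k (W k) ≡⟨ cong (λ t → Δmulti k f (W k) + c * t) (tensorΔ-diag k (W k)) ⟩
    Δmulti k f (W k) + c * 1ℚ       ≡⟨ solve 2 (λ v e → e :+ (v :- e) :* con 1ℚ := v) refl (v k) (Δmulti k f (W k)) ⟩
    v k ∎
  solves j (there j∈L) = begin
    _                               ≡⟨ Δh j ⟩
    Δmulti j f (W j) + c * tensorΔ j k (W j) ≡⟨ cong (λ t → Δmulti j f (W j) + c * t) (tensorΔ-⋠ j k (W j) (All.lookup later j∈L)) ⟩
    Δmulti j f (W j) + c * 0ℚ       ≡⟨ solve 2 (λ e c → e :+ c :* con 0ℚ := e) refl (Δmulti j f (W j)) c ⟩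
    Δmulti j f (W j)                ≡⟨ f-solves j j∈L ⟩
    v j ∎

-- Counting tuples

⪯-refl : ∀ (k : Vec ℕ d) → k ⪯ k
⪯-refl k i = ℕₚ.≤-refl

⪯-trans : ∀ (k l m : Vec ℕ d) → k ⪯ l → l ⪯ m → k ⪯ m
⪯-trans k l m k⪯l l⪯m i = ℕₚ.≤-trans (k⪯l i) (l⪯m i)

lookup-ext : ∀ {A : Set} {u v : Vec A d} → (∀ i → lookup u i ≡ lookup v i) → u ≡ v
lookup-ext {u = []}     {[]}     eq = refl
lookup-ext {u = a ∷ u} {b ∷ v} eq = cong₂ _∷_ (eq zero) (lookup-ext (eq ∘ suc))

⪯-antisym : ∀ (k l : Vec ℕ d) → k ⪯ l → l ⪯ k → k ≡ l
⪯-antisym k l k⪯l l⪯k = lookup-ext (λ i → ℕₚ.≤-antisym (k⪯l i) (l⪯k i))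

lookup-step-≡ : ∀ (k : Vec ℕ d) i → lookup (step k i) i ≡ suc (lookup k i)
lookup-step-≡ k i = Vecₚ.lookup∘updateAt i k

lookup-step-≢ : ∀ (k : Vec ℕ d) {i j} → i ≢ j → lookup (step k j) i ≡ lookup k i
lookup-step-≢ k {i} {j} i≢j = Vecₚ.lookup∘updateAt′ i j i≢j k

⪯-step : ∀ (k : Vec ℕ d) i → k ⪯ step k i
⪯-step k i j with j Fin.≟ i
... | yes refl = ℕₚ.≤-trans (ℕₚ.n≤1+n _) (ℕₚ.≤-reflexive (sym (lookup-step-≡ k i)))
... | no j≢i   = ℕₚ.≤-reflexive (sym (lookup-step-≢ k j≢i))

step-⪯ : ∀ (k m : Vec ℕ d) i → k ⪯ m → lookup k i < lookup m i → step k i ⪯ m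
step-⪯ k m i k⪯m k<m j with j Fin.≟ i
... | yes refl = ℕₚ.≤-trans (ℕₚ.≤-reflexive (lookup-step-≡ k i)) k<m
... | no j≢i   = ℕₚ.≤-trans (ℕₚ.≤-reflexive (lookup-step-≢ k j≢i)) (k⪯m j)

sum-step : ∀ (k : Vec ℕ d) i → Vec.sum (step k i) ≡ suc (Vec.sum k)
sum-step (k ∷ ks) zero    = refl
sum-step (k ∷ ks) (suc i) = trans (cong (k ℕ.+_) (sum-step ks i)) (ℕₚ.+-suc k (Vec.sum ks))

sum-mono : ∀ (k m : Vec ℕ d) → k ⪯ m → Vec.sum k ≤ Vec.sum m
sum-mono []       []       k⪯m = z≤n
sum-mono (_ ∷ ks) (_ ∷ ms) k⪯m = ℕₚ.+-mono-≤ (k⪯m zero) (sum-mono ks ms (k⪯m ∘ suc))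

0⪯ : ∀ (m : Vec ℕ d) → replicate d 0 ⪯ m
0⪯ m i = subst (_≤ lookup m i) (sym (Vecₚ.lookup-replicate i 0)) z≤n

concatMap-map : ∀ {A B C : Set} (f : A → B → C) xs ys →
                concatMap (λ x → List.map (f x) ys) xs ≡ cartesianProductWith f xs ys
concatMap-map f []       ys = refl
concatMap-map f (x ∷ xs) ys = cong (List.map (f x) ys ++_) (concatMap-map f xs ys)

∈-box⁺ : ∀ (k n : Vec ℕ d) → k ⪯ n → k ∈ box n
∈-box⁺ []       []      k⪯n = here refl
∈-box⁺ (k ∷ ks) (m ∷ n) k⪯n = subst ((k ∷ ks) ∈_) (sym (concatMap-map _∷_ (upTo (suc m)) (box n)))
  (∈ₚ.∈-cartesianProductWith⁺ _∷_ (∈ₚ.∈-upTo⁺ (s≤s (k⪯n zero))) (∈-box⁺ ks n (k⪯n ∘ suc)))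

∈-box⁻ : ∀ (n : Vec ℕ d) {k} → k ∈ box n → k ⪯ n
∈-box⁻ []      (here refl) ()
∈-box⁻ (m ∷ n) k∈
  with j , l , j∈ , l∈ , refl ← ∈ₚ.∈-cartesianProductWith⁻ _∷_ (upTo (suc m)) (box n)
                                  (subst (_ ∈_) (concatMap-map _∷_ (upTo (suc m)) (box n)) k∈) =
  λ { zero → ℕ.s≤s⁻¹ (∈ₚ.∈-upTo⁻ j∈) ; (suc i) → ∈-box⁻ n l∈ i }

-- The lexicographic order of `box` is a linear extension of `⪯`: between blocks the head decides,
-- and within a block the tails do.
box-ordered : ∀ (n : Vec ℕ d) → AllPairs (λ k j → ¬ j ⪯ k) (box n)
box-ordered []      = [] ∷ []
box-ordered (m ∷ n) = AllPairsₚ.concat⁺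
  (Allₚ.map⁺ (All.universal (λ j → AllPairsₚ.map⁺ (AllPairs.map (λ k⋡j le → k⋡j (le ∘ suc)) (box-ordered n))) (upTo (suc m))))
  (AllPairsₚ.map⁺ (AllPairsₚ.applyUpTo⁺₁ id (suc m) (λ i<j _ →
    Allₚ.map⁺ (All.universal (λ _ → Allₚ.map⁺ (All.universal (λ _ le → ℕₚ.<⇒≱ i<j (le zero)) (box n))) (box n)))))

box-unique : ∀ (n : Vec ℕ d) → Unique (box n)
box-unique n = AllPairs.map (λ j⋠k eq → j⋠k (λ i → ℕₚ.≤-reflexive (cong (λ v → lookup v i) (sym eq)))) (box-ordered n)

module _ {A B C : Set} (f : A → B → C) where

  length-cartesianProductWith : ∀ xs ys → length (cartesianProductWith f xs ys) ≡ length xs ℕ.* length ys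
  length-cartesianProductWith []       ys = refl
  length-cartesianProductWith (x ∷ xs) ys = trans (Listₚ.length-++ (List.map (f x) ys))
    (cong₂ ℕ._+_ (Listₚ.length-map (f x) ys) (length-cartesianProductWith xs ys))

  -- Injectivity is asked for on members only, because `zipWith _++_` is injective only among
  -- prefixes of equal lengths.
  cartesianProductWith-unique : ∀ xs ys →
    (∀ {w x y z} → w ∈ xs → x ∈ xs → y ∈ ys → z ∈ ys → f w y ≡ f x z → w ≡ x × y ≡ z) →
    Unique xs → Unique ys → Unique (cartesianProductWith f xs ys)
  cartesianProductWith-unique []       ys inj uxs          uys = []
  cartesianProductWith-unique (x ∷ xs) ys inj (x∉xs ∷ uxs) uys =
    Uniqueₚ.++⁺ (row ys id uys)
      (cartesianProductWith-unique xs ys (λ w∈ x∈ → inj (there w∈) (there x∈)) uxs uys)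
      disjoint
    where
    row : ∀ zs → (∀ {z} → z ∈ zs → z ∈ ys) → Unique zs → Unique (List.map (f x) zs)
    row []       sub []         = []
    row (z ∷ zs) sub (z∉ ∷ uzs) =
      Allₚ.map⁺ (All.tabulate (λ z′∈ eq → All.lookup z∉ z′∈
        (proj₂ (inj (here refl) (here refl) (sub (here refl)) (sub (there z′∈)) eq))))
      ∷ row zs (sub ∘ there) uzs
    disjoint : Disjoint (List.map (f x) ys) (cartesianProductWith f xs ys)
    disjoint (v∈ , v∈′) with ∈ₚ.∈-map⁻ (f x) v∈ | ∈ₚ.∈-cartesianProductWith⁻ f xs ys v∈′
    ... | y , y∈ , v≡ | w , z , w∈ , z∈ , v≡′ =
      All.lookup x∉xs w∈ (proj₁ (inj (here refl) (there w∈) y∈ z∈ (trans (sym v≡) v≡′)))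

vectors : ∀ {A : Set} → Vec (List A) d → List (Vec A d)
vectors []       = [] ∷ []
vectors (l ∷ ls) = cartesianProductWith _∷_ l (vectors ls)

module _ {A : Set} where

  ∈-vectors⁺ : ∀ (ls : Vec (List A) d) a → (∀ i → lookup a i ∈ lookup ls i) → a ∈ vectors ls
  ∈-vectors⁺ []       []       a∈ = here refl
  ∈-vectors⁺ (l ∷ ls) (b ∷ bs) a∈ = ∈ₚ.∈-cartesianProductWith⁺ _∷_ (a∈ zero) (∈-vectors⁺ ls bs (a∈ ∘ suc))

  ∈-vectors⁻ : ∀ (ls : Vec (List A) d) {a} → a ∈ vectors ls → ∀ i → lookup a i ∈ lookup ls i
  ∈-vectors⁻ (l ∷ ls) a∈ i with ∈ₚ.∈-cartesianProductWith⁻ _∷_ l (vectors ls) a∈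
  ∈-vectors⁻ (l ∷ ls) a∈ zero    | _ , _ , b∈ , _   , refl = b∈
  ∈-vectors⁻ (l ∷ ls) a∈ (suc i) | _ , _ , _  , bs∈ , refl = ∈-vectors⁻ ls bs∈ i

  vectors-unique : ∀ (ls : Vec (List A) d) → (∀ i → Unique (lookup ls i)) → Unique (vectors ls)
  vectors-unique []       u = [] ∷ []
  vectors-unique (l ∷ ls) u = Uniqueₚ.cartesianProductWith⁺ _∷_ Vecₚ.∷-injective (u zero) (vectors-unique ls (u ∘ suc))

-- Sorted sequences in an interval

record SortedIn (lo hi m : ℕ) (l : List ℕ) : Set where
  constructor sortedIn
  field
    len    : length l ≡ m
    sorted : AllPairs _≤_ l
    ≥lo    : All (lo ≤_) l
    <hi    : All (_< hi) l

-- The interval starts at `lo` and has width `w`. A nonempty sorted sequence either begins with `lo`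
-- or lies entirely in the interval with `lo` removed; this is the recursion of `rising-Δ`.
sortedLists : ℕ → ℕ → ℕ → List (List ℕ)
sortedLists lo w       zero    = [] ∷ []
sortedLists lo zero    (suc m) = []
sortedLists lo (suc w) (suc m) = List.map (lo ∷_) (sortedLists lo (suc w) m) ++ sortedLists (suc lo) w (suc m)

∈-sortedLists⁺ : ∀ lo w m {l} → SortedIn lo (lo ℕ.+ w) m l → l ∈ sortedLists lo w m
∈-sortedLists⁺ lo w       zero    {[]}    _ = here refl
∈-sortedLists⁺ lo zero    (suc m) {a ∷ l} (sortedIn _ _ (lo≤a ∷ _) (a<hi ∷ _)) =
  ⊥-elim (ℕₚ.<⇒≱ a<hi (subst (_≤ a) (sym (ℕₚ.+-identityʳ lo)) lo≤a))
∈-sortedLists⁺ lo (suc w) (suc m) {a ∷ l} (sortedIn len (a≤ ∷ sorted) (lo≤a ∷ ≥lo) (a<hi ∷ <hi)) with lo ℕ.≟ a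
... | yes refl = ∈ₚ.∈-++⁺ˡ (∈ₚ.∈-map⁺ (lo ∷_) (∈-sortedLists⁺ lo (suc w) m (sortedIn (ℕₚ.suc-injective len) sorted ≥lo <hi)))
... | no lo≢a  = ∈ₚ.∈-++⁺ʳ _ (∈-sortedLists⁺ (suc lo) w (suc m)
  (sortedIn len (a≤ ∷ sorted) (lo<a ∷ All.map (ℕₚ.≤-trans lo<a) a≤)
    (subst (λ hi → All (_< hi) (a ∷ l)) (ℕₚ.+-suc lo w) (a<hi ∷ <hi))))
  where lo<a = ℕₚ.≤∧≢⇒< lo≤a lo≢a

∈-sortedLists⁻ : ∀ lo w m {l} → l ∈ sortedLists lo w m → SortedIn lo (lo ℕ.+ w) m l
∈-sortedLists⁻ lo w       zero    (here refl) = sortedIn refl [] [] []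
∈-sortedLists⁻ lo (suc w) (suc m) {l} l∈ with ∈ₚ.∈-++⁻ (List.map (lo ∷_) (sortedLists lo (suc w) m)) l∈
... | inj₁ l∈₁ with l , l∈′ , refl ← ∈ₚ.∈-map⁻ (lo ∷_) l∈₁
               with sortedIn len sorted ≥lo <hi ← ∈-sortedLists⁻ lo (suc w) m l∈′ =
  sortedIn (cong suc len) (≥lo ∷ sorted) (ℕₚ.≤-refl ∷ ≥lo) (ℕₚ.m<m+n lo (s≤s z≤n) ∷ <hi)
... | inj₂ l∈₂ with sortedIn len sorted ≥lo <hi ← ∈-sortedLists⁻ (suc lo) w (suc m) l∈₂ =
  sortedIn len sorted (All.map ℕₚ.<⇒≤ ≥lo) (subst (λ hi → All (_< hi) l) (sym (ℕₚ.+-suc lo w)) <hi)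

sortedLists-unique : ∀ lo w m → Unique (sortedLists lo w m)
sortedLists-unique lo w       zero    = [] ∷ []
sortedLists-unique lo zero    (suc m) = []
sortedLists-unique lo (suc w) (suc m) = Uniqueₚ.++⁺
  (Uniqueₚ.map⁺ Listₚ.∷-injectiveʳ (sortedLists-unique lo (suc w) m))
  (sortedLists-unique (suc lo) w (suc m))
  disjoint
  where
  disjoint : Disjoint (List.map (lo ∷_) (sortedLists lo (suc w) m)) (sortedLists (suc lo) w (suc m))
  disjoint (v∈ , v∈′) with ∈ₚ.∈-map⁻ (lo ∷_) v∈ | ∈-sortedLists⁻ (suc lo) w (suc m) v∈′
  ... | _ , _ , refl | sortedIn _ _ (lo<lo ∷ _) _ = ℕₚ.<-irrefl refl lo<lo

-- Same recursion as `risingΔ`: for k > m there is no list at all, whereas length `m ∸ k` would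
-- still allow the empty one.
suffixes : ℕ → ℕ → ℕ → ℕ → List (List ℕ)
suffixes lo w zero    m       = sortedLists lo w m
suffixes lo w (suc k) zero    = []
suffixes lo w (suc k) (suc m) = suffixes lo w k m

∈-suffixes⁺ : ∀ lo w k r {l} → SortedIn lo (lo ℕ.+ w) r l → l ∈ suffixes lo w k (k ℕ.+ r)
∈-suffixes⁺ lo w zero    r s = ∈-sortedLists⁺ lo w r s
∈-suffixes⁺ lo w (suc k) r s = ∈-suffixes⁺ lo w k r s

∈-suffixes⁻ : ∀ lo w k m {l} → l ∈ suffixes lo w k m → ∃[ r ] k ℕ.+ r ≡ m × SortedIn lo (lo ℕ.+ w) r l
∈-suffixes⁻ lo w zero    m       l∈ = m , refl , ∈-sortedLists⁻ lo w m l∈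
∈-suffixes⁻ lo w (suc k) (suc m) l∈ with r , eq , s ← ∈-suffixes⁻ lo w k m l∈ = r , cong suc eq , s

suffixes-unique : ∀ lo w k m → Unique (suffixes lo w k m)
suffixes-unique lo w zero    m       = sortedLists-unique lo w m
suffixes-unique lo w (suc k) zero    = []
suffixes-unique lo w (suc k) (suc m) = suffixes-unique lo w k m

tuples : Vec ℕ d → Vec ℕ d → List (Vec (List ℕ) d)
tuples x m = vectors (zipWith (sortedLists 0) x m)

∈-tuples⁺ : ∀ (x m : Vec ℕ d) a → InI x m a → a ∈ tuples x m
∈-tuples⁺ x m a a∈I = ∈-vectors⁺ (zipWith (sortedLists 0) x m) a (λ i →
  let len , sorted , <x = a∈I i in
  subst (lookup a i ∈_) (sym (Vecₚ.lookup-zipWith (sortedLists 0) i x m))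
    (∈-sortedLists⁺ 0 (lookup x i) (lookup m i)
      (sortedIn len (Linked⇒AllPairs ℕₚ.≤-trans sorted) (All.universal (λ _ → z≤n) (lookup a i)) <x)))

∈-tuples⁻ : ∀ (x m : Vec ℕ d) {a} → a ∈ tuples x m → InI x m a
∈-tuples⁻ x m a∈ i
  with sortedIn len sorted _ <x ← ∈-sortedLists⁻ 0 (lookup x i) (lookup m i)
         (subst (_ ∈_) (Vecₚ.lookup-zipWith (sortedLists 0) i x m) (∈-vectors⁻ (zipWith (sortedLists 0) x m) a∈ i)) =
  len , AllPairs⇒Linked sorted , <x

tuples-unique : ∀ (x m : Vec ℕ d) → Unique (tuples x m)
tuples-unique x m = vectors-unique (zipWith (sortedLists 0) x m) (λ i →
  subst Unique (sym (Vecₚ.lookup-zipWith (sortedLists 0) i x m)) (sortedLists-unique 0 (lookup x i) (lookup m i)))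

-- Lattice paths and the greedy walk

endpoint : Vec ℕ d → List (Fin d) → Vec ℕ d
endpoint = foldl step

⪯-endpoint : ∀ (k : Vec ℕ d) P → k ⪯ endpoint k P
⪯-endpoint k []      = ⪯-refl k
⪯-endpoint k (i ∷ P) = ⪯-trans k (step k i) (endpoint (step k i) P) (⪯-step k i) (⪯-endpoint (step k i) P)

<-endpoint : ∀ (k : Vec ℕ d) i P → lookup k i < lookup (endpoint k (i ∷ P)) i
<-endpoint k i P = ℕₚ.≤-trans (ℕₚ.≤-reflexive (sym (lookup-step-≡ k i))) (⪯-endpoint (step k i) P i)

lookup-endpoint : ∀ (k : Vec ℕ d) P i → lookup (endpoint k P) i ≡ lookup k i ℕ.+ length (filter (Fin._≟ i) P)
lookup-endpoint k []      i = sym (ℕₚ.+-identityʳ (lookup k i))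
lookup-endpoint k (j ∷ P) i with j Fin.≟ i | lookup-endpoint (step k j) P i
... | yes refl | eq = trans eq (trans (cong (ℕ._+ _) (lookup-step-≡ k j)) (sym (ℕₚ.+-suc (lookup k j) _)))
... | no j≢i   | eq = trans eq (cong (ℕ._+ _) (lookup-step-≢ k (j≢i ∘ sym)))

isPath⇔endpoint : ∀ (n : Vec ℕ d) P → IsPath n P ⇔ (endpoint (replicate d 0) P ≡ n)
isPath⇔endpoint {d} n P = mk⇔
  (λ path → lookup-ext (λ i → trans (count i) (path i)))
  (λ eq i → trans (sym (count i)) (cong (λ v → lookup v i) eq))
  where
  count : ∀ i → lookup (endpoint (replicate d 0) P) i ≡ length (filter (Fin._≟ i) P)
  count i = trans (lookup-endpoint (replicate d 0) P i) (cong (ℕ._+ length (filter (Fin._≟ i) P)) (Vecₚ.lookup-replicate i 0))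

at-++ : ∀ l r j {v} → l at j ≡ v → (l ++ r) at j ≡ v
at-++ []      r zero    ()
at-++ []      r (suc j) ()
at-++ (a ∷ l) r zero    eq = eq
at-++ (a ∷ l) r (suc j) eq = at-++ l r j eq

at-length : ∀ l {r v} → (l ++ r) at (length l) ≡ v → r at 0 ≡ v
at-length []      eq = eq
at-length (a ∷ l) eq = at-length l eq

at-take : ∀ l {s j v} → j < s → l at j ≡ v → take s l at j ≡ v
at-take []      {suc s} {zero}  j<s ()
at-take []      {suc s} {suc j} j<s ()
at-take (a ∷ l) {suc s} {zero}  j<s       eq = eq
at-take (a ∷ l) {suc s} {suc j} (s≤s j<s) eq = at-take l j<s eq

all-at : ∀ {P : ℕ → Set} l → (∀ j → j < length l → ∃[ v ] (l at j ≡ v × P v)) → All P l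
all-at []      h = []
all-at (a ∷ l) h with _ , refl , p ← h 0 (s≤s z≤n) = p ∷ all-at l (λ j j< → h (suc j) (s≤s j<))

Safe : Vec (List ℕ) d → (Vec ℕ d → Vec ℕ d) → Vec ℕ d → Fin d → Set
Safe a U k i = ∃[ v ] (lookup a i at lookup k i ≡ v × v < lookup (U k) i)

safe? : ∀ (a : Vec (List ℕ) d) U k i → Dec (Safe a U k i)
safe? a U k i with List.head (drop (lookup k i) (lookup a i))
... | nothing = no λ { (_ , () , _) }
... | just v with v ℕ.<? lookup (U k) i
...   | yes v<u = yes (v , refl , v<u)
...   | no v≮u  = no λ { (_ , refl , v<u) → v≮u v<u }

Stuck : Vec (List ℕ) d → (Vec ℕ d → Vec ℕ d) → Vec ℕ d → Vec ℕ d → Set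
Stuck a U m k = ∀ i → lookup k i < lookup m i → ¬ Safe a U k i

module _ (a : Vec (List ℕ) d) (U : Vec ℕ d → Vec ℕ d) (m : Vec ℕ d) where

  -- Take any allowed step inside the box of `m` as long as there is one. Each step raises the
  -- coordinate sum by one, so the distance of the sums bounds the number of steps.
  maximal-path-from : ∀ fuel k → k ⪯ m → Vec.sum m ≤ fuel ℕ.+ Vec.sum k →
                      ∃[ P ] (endpoint k P ⪯ m × BoundedFrom a U k P × Stuck a U m (endpoint k P))
  maximal-path-from fuel k k⪯m enough with Finₚ.any? (λ i → (lookup k i ℕ.<? lookup m i) ×-dec safe? a U k i)
  ... | no none = [] , k⪯m , _ , λ i k<m safe → none (i , k<m , safe)
  -- Without fuel the sum of `k` is already that of `m`, and a further step would leave the box.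
  maximal-path-from zero       k k⪯m enough | yes (i , k<m , safe) =
    ⊥-elim (ℕₚ.<⇒≱ (subst (_≤ Vec.sum m) (sum-step k i) (sum-mono (step k i) m (step-⪯ k m i k⪯m k<m))) enough)
  maximal-path-from (suc fuel) k k⪯m enough | yes (i , k<m , safe)
    with P , P⪯m , bounded , stuck ← maximal-path-from fuel (step k i) (step-⪯ k m i k⪯m k<m)
      (ℕₚ.≤-trans enough (ℕₚ.≤-reflexive (trans (sym (ℕₚ.+-suc fuel (Vec.sum k))) (cong (fuel ℕ.+_) (sym (sum-step k i)))))) =
    i ∷ P , P⪯m , (safe , bounded) , stuck

  maximal-path : ∃[ P ] (endpoint (replicate d 0) P ⪯ m × BoundedFrom a U (replicate d 0) P
                         × Stuck a U m (endpoint (replicate d 0) P))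
  maximal-path = maximal-path-from (Vec.sum m) (replicate d 0) (0⪯ m) (ℕₚ.m≤m+n _ _)

Reaches : Vec (List ℕ) d → (Vec ℕ d → Vec ℕ d) → Vec ℕ d → Set
Reaches {d} a U m = ∃[ P ] (endpoint (replicate d 0) P ≡ m × BoundedFrom a U (replicate d 0) P)

bounded-++ : ∀ (a r : Vec (List ℕ) d) U k P → BoundedFrom a U k P → BoundedFrom (zipWith _++_ a r) U k P
bounded-++ a r U k []      _ = _
bounded-++ a r U k (i ∷ P) ((v , at , v<u) , bounded) =
  (v , subst (_at lookup k i ≡ v) (sym (Vecₚ.lookup-zipWith _++_ i a r)) (at-++ (lookup a i) (lookup r i) (lookup k i) at) , v<u) ,
  bounded-++ a r U (step k i) P bounded

-- A path ending in the box of `s` reads only positions below `s`, and truncation keeps these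
-- entries.
bounded-take : ∀ (a : Vec (List ℕ) d) U s k P → endpoint k P ⪯ s →
               BoundedFrom a U k P → BoundedFrom (zipWith take s a) U k P
bounded-take a U s k []      P⪯s _ = _
bounded-take a U s k (i ∷ P) P⪯s ((v , at , v<u) , bounded) =
  (v , subst (_at lookup k i ≡ v) (sym (Vecₚ.lookup-zipWith take i s a))
         (at-take (lookup a i) (ℕₚ.<-≤-trans (<-endpoint k i P) (P⪯s i)) at) , v<u) ,
  bounded-take a U s (step k i) P P⪯s bounded

-- Reachability of `k` is tested on one path only, the greedy one in the box of `k`. For monotone
-- bounds and `k ⪯ n` this finds every reachable `k`, by `∈-reaching⁺`.
reaches? : ∀ (U : Vec ℕ d → Vec ℕ d) k a → Dec (endpoint (replicate d 0) (proj₁ (maximal-path a U k)) ≡ k)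
reaches? U k a = Vecₚ.≡-dec ℕ._≟_ (endpoint (replicate _ 0) (proj₁ (maximal-path a U k))) k

reaching : Vec ℕ d → (Vec ℕ d → Vec ℕ d) → Vec ℕ d → List (Vec (List ℕ) d)
reaching x U k = filter (reaches? U k) (tuples x k)

∈-reaching⁻ : ∀ (x : Vec ℕ d) U k {a} → a ∈ reaching x U k → InI x k a × Reaches a U k
∈-reaching⁻ x U k {a} a∈ with a∈tuples , eq ← ∈ₚ.∈-filter⁻ (reaches? U k) {xs = tuples x k} a∈ =
  ∈-tuples⁻ x k a∈tuples , proj₁ (maximal-path a U k) , eq , proj₁ (proj₂ (proj₂ (maximal-path a U k)))

reaching-unique : ∀ (x : Vec ℕ d) U k → Unique (reaching x U k)
reaching-unique x U k = Uniqueₚ.filter⁺ _ (tuples-unique x k)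

module Monotone
  (n : Vec ℕ d) (U : Vec ℕ d → Vec ℕ d)
  (U-mono : ∀ k k′ → k ⪯ k′ → k′ ⪯ n → ∀ i → lookup (U k) i ≤ lookup (U k′) i)
  where

  -- The first step leaving the box below a stuck point s would be available at s as well.
  stuck-dominates : ∀ a m s → m ⪯ n → s ⪯ m → Stuck a U m s →
                    ∀ k P → k ⪯ s → endpoint k P ⪯ m → BoundedFrom a U k P → endpoint k P ⪯ s
  stuck-dominates a m s m⪯n s⪯m stuck k []      k⪯s P⪯m _ = k⪯s
  stuck-dominates a m s m⪯n s⪯m stuck k (i ∷ P) k⪯s P⪯m ((v , at , v<u) , bounded) with lookup k i ℕ.<? lookup s i
  ... | yes k<s = stuck-dominates a m s m⪯n s⪯m stuck (step k i) P (step-⪯ k s i k⪯s k<s) P⪯m bounded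
  ... | no k≮s  = ⊥-elim (stuck i s<m
      (v , subst (lookup a i at_≡ v) k≡s at , ℕₚ.<-≤-trans v<u (U-mono k s k⪯s (⪯-trans s m n s⪯m m⪯n) i)))
    where
    k≡s = ℕₚ.≤-antisym (k⪯s i) (ℕₚ.≮⇒≥ k≮s)
    s<m = subst (_< lookup m i) k≡s (ℕₚ.<-≤-trans (<-endpoint k i P) (P⪯m i))

  -- Each of the two stuck points dominates the endpoint of the path to the other.
  stuck-unique : ∀ a m s t → m ⪯ n → s ⪯ m → t ⪯ m → Stuck a U m s → Stuck a U m t →
                 Reaches a U s → Reaches a U t → s ≡ t
  stuck-unique a m s t m⪯n s⪯m t⪯m stuck-s stuck-t (P , refl , P-bounded) (Q , refl , Q-bounded) = ⪯-antisym s t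
    (stuck-dominates a m t m⪯n t⪯m stuck-t (replicate d 0) P (0⪯ t) s⪯m P-bounded)
    (stuck-dominates a m s m⪯n s⪯m stuck-s (replicate d 0) Q (0⪯ s) t⪯m Q-bounded)

  -- The bound met when position `j` is read is at most the bound at the endpoint, as `U` grows
  -- along the path. So all entries read lie below the range of a suffix attached at the endpoint.
  bounded-at : ∀ (a : Vec (List ℕ) d) k P → endpoint k P ⪯ n → BoundedFrom a U k P →
               ∀ i j → lookup k i ≤ j → j < lookup (endpoint k P) i →
               ∃[ v ] (lookup a i at j ≡ v × v < lookup (U (endpoint k P)) i)
  bounded-at a k []       P⪯n _ i j k≤j j<k = ⊥-elim (ℕₚ.<⇒≱ j<k k≤j)
  bounded-at a k (i′ ∷ P) P⪯n ((v , at , v<u) , bounded) i j k≤j j<P with i Fin.≟ i′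
  ... | no i≢i′  = bounded-at a (step k i′) P P⪯n bounded i j (subst (_≤ j) (sym (lookup-step-≢ k i≢i′)) k≤j) j<P
  ... | yes refl with lookup k i ℕ.≟ j
  ...   | yes refl = v , at , ℕₚ.<-≤-trans v<u (U-mono k (endpoint k (i ∷ P)) (⪯-endpoint k (i ∷ P)) P⪯n i)
  ...   | no k≢j   = bounded-at a (step k i) P P⪯n bounded i j
                       (subst (_≤ j) (sym (lookup-step-≡ k i)) (ℕₚ.≤∧≢⇒< k≤j k≢j)) j<P

  -- The greedy walk in the box of `k` gets stuck at some `s`. By `stuck-dominates` the given path
  -- ends below `s`, so `k ⪯ s`, and the two agree.
  ∈-reaching⁺ : ∀ x k a → k ⪯ n → InI x k a → Reaches a U k → a ∈ reaching x U k
  ∈-reaching⁺ x k a k⪯n a∈I (P , end , bounded) = ∈ₚ.∈-filter⁺ (reaches? U k) (∈-tuples⁺ x k a a∈I) reaches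
    where
    reaches : endpoint (replicate d 0) (proj₁ (maximal-path a U k)) ≡ k
    reaches with Q , Q⪯k , _ , stuck ← maximal-path a U k = ⪯-antisym s k Q⪯k (subst (_⪯ s) end
      (stuck-dominates a k s k⪯n Q⪯k stuck (replicate d 0) P (0⪯ s) (subst (_⪯ k) (sym end) (⪯-refl k)) bounded))
      where s = endpoint (replicate d 0) Q

  -- Filtering tuples, rather than listing pairs of a tuple and a path, counts each tuple once
  -- however many paths bound it.
  enumerates-reaching : ∀ x → Enumerates x n U (reaching x U n)
  enumerates-reaching x = reaching-unique x U n , λ a → mk⇔
    (λ a∈ → let a∈I , P , end , bounded = ∈-reaching⁻ x U n a∈ in
            P , Equivalence.from (isPath⇔endpoint n P) end , a∈I , bounded)
    (λ { (P , path , a∈I , bounded) →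
         ∈-reaching⁺ x n a (⪯-refl n) a∈I (P , Equivalence.to (isPath⇔endpoint n P) path , bounded) })

Uof-mono : ∀ (x n : Vec ℕ d) Z → (∀ k k′ → k ⪯ k′ → k′ ⪯ n → ∀ i → lookup (Z k′) i ≤ lookup (Z k) i) →
           ∀ k k′ → k ⪯ k′ → k′ ⪯ n → ∀ i → lookup (Uof x Z k) i ≤ lookup (Uof x Z k′) i
Uof-mono x n Z Z-anti k k′ k⪯k′ k′⪯n i =
  subst₂ _≤_ (sym (Vecₚ.lookup-zipWith ℕ._∸_ i x (Z k))) (sym (Vecₚ.lookup-zipWith ℕ._∸_ i x (Z k′)))
    (ℕₚ.∸-monoʳ-≤ (lookup x i) (Z-anti k k′ k⪯k′ k′⪯n i))

length-cong : ∀ {A : Set} {L M : List A} → Unique L → Unique M → (∀ a → (a ∈ L) ⇔ (a ∈ M)) → length L ≡ length M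
length-cong uL uM same = ↭-length (∼bag⇒↭ (unique∧set⇒bag uL uM (same _)))

-- Splitting a tuple at its stuck point

tails : Vec ℕ d → Vec ℕ d → Vec ℕ d → Vec ℕ d → Vec (List (List ℕ)) d
tails []       []       []       []       = []
tails (u ∷ us) (z ∷ zs) (k ∷ ks) (m ∷ ms) = suffixes u z k m ∷ tails us zs ks ms

lookup-tails : ∀ (u z k m : Vec ℕ d) i → lookup (tails u z k m) i ≡
               suffixes (lookup u i) (lookup z i) (lookup k i) (lookup m i)
lookup-tails (u ∷ us) (z ∷ zs) (k ∷ ks) (m ∷ ms) zero    = refl
lookup-tails (u ∷ us) (z ∷ zs) (k ∷ ks) (m ∷ ms) (suc i) = lookup-tails us zs ks ms i

++-cancel : ∀ {A : Set} (l l′ : List A) {r r′} → length l ≡ length l′ → l ++ r ≡ l′ ++ r′ → l ≡ l′ × r ≡ r′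
++-cancel []      []        len eq = refl , eq
++-cancel (a ∷ l) (b ∷ l′) len eq with refl , eq′ ← Listₚ.∷-injective eq
                                  with refl , r≡ ← ++-cancel l l′ (ℕₚ.suc-injective len) eq′ = refl , r≡

module Decomposition
  (x n : Vec ℕ d) (Z : Vec ℕ d → Vec ℕ d)
  (Z<x : ∀ k → k ⪯ n → ∀ i → lookup (Z k) i < lookup x i)
  (Z-anti : ∀ k k′ → k ⪯ k′ → k′ ⪯ n → ∀ i → lookup (Z k′) i ≤ lookup (Z k) i)
  (m : Vec ℕ d) (m⪯n : m ⪯ n)
  where

  private
    U = Uof x Z

    open module M = Monotone n U (Uof-mono x n Z Z-anti)

    U+Z : ∀ k → k ⪯ n → ∀ i → lookup (U k) i ℕ.+ lookup (Z k) i ≡ lookup x i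
    U+Z k k⪯n i = trans (cong (ℕ._+ lookup (Z k) i) (Vecₚ.lookup-zipWith ℕ._∸_ i x (Z k))) (ℕₚ.m∸n+n≡m (ℕₚ.<⇒≤ (Z<x k k⪯n i)))

  ending : Vec ℕ d → List (Vec (List ℕ) d)
  ending k = vectors (tails (U k) (Z k) k m)

  -- The tuples of `m` whose greedy walk ends at `k`. If `k ⪯ m` fails, some list of suffixes is
  -- empty and so is this one; hence `k` may range over `box n` for every `m`.
  decomposed : Vec ℕ d → List (Vec (List ℕ) d)
  decomposed k = cartesianProductWith (zipWith _++_) (reaching x U k) (ending k)

  ∈-ending⁻ : ∀ k {r} → r ∈ ending k → ∀ i →
              ∃[ j ] lookup k i ℕ.+ j ≡ lookup m i × SortedIn (lookup (U k) i) (lookup (U k) i ℕ.+ lookup (Z k) i) j (lookup r i)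
  ∈-ending⁻ k {r} r∈ i = ∈-suffixes⁻ (lookup (U k) i) (lookup (Z k) i) (lookup k i) (lookup m i)
    (subst (lookup r i ∈_) (lookup-tails (U k) (Z k) k m i) (∈-vectors⁻ (tails (U k) (Z k) k m) r∈ i))

  ending⇒⪯ : ∀ k {r} → r ∈ ending k → k ⪯ m
  ending⇒⪯ k r∈ i with j , k+j≡m , _ ← ∈-ending⁻ k r∈ i = subst (lookup k i ≤_) k+j≡m (ℕₚ.m≤m+n (lookup k i) j)

  -- At the seam the order is kept because prefix entries are below `U k`, by `bounded-at`, and
  -- suffix entries are not. The upper bound comes from u + z = x.
  decomposed-InI : ∀ k {b r} → b ∈ reaching x U k → r ∈ ending k → InI x m (zipWith _++_ b r)
  decomposed-InI k {b} {r} b∈ r∈ i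
    with b∈I , P , refl , bounded ← ∈-reaching⁻ x U k b∈
    with len , sorted , <x ← b∈I i
    with j , k+j≡m , sortedIn len′ sorted′ ≥u <u+z ← ∈-ending⁻ k r∈ i =
    subst (λ l → length l ≡ lookup m i × Sorted l × All (_< lookup x i) l) (sym (Vecₚ.lookup-zipWith _++_ i b r))
      ( trans (Listₚ.length-++ (lookup b i)) (trans (cong₂ ℕ._+_ len len′) k+j≡m)
      , AllPairs⇒Linked (AllPairsₚ.++⁺ (Linked⇒AllPairs ℕₚ.≤-trans sorted) sorted′
          (All.map (λ b<u → All.map (ℕₚ.≤-trans (ℕₚ.<⇒≤ b<u)) ≥u) <u))
      , Allₚ.++⁺ <x (subst (λ y → All (_< y) (lookup r i)) (U+Z k k⪯n i) <u+z) )
    where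
    k⪯n = ⪯-trans k m n (ending⇒⪯ k r∈) m⪯n
    <u : All (_< lookup (U k) i) (lookup b i)
    <u = all-at (lookup b i) (λ j j< → bounded-at b (replicate d 0) P k⪯n bounded i j 
                             (subst (_≤ j) (sym (Vecₚ.lookup-replicate i 0)) z≤n) (subst (j <_) len j<))

  decomposed-Reaches : ∀ k {b r} → b ∈ reaching x U k → Reaches (zipWith _++_ b r) U k
  decomposed-Reaches k {b} {r} b∈ with _ , P , end , bounded ← ∈-reaching⁻ x U k b∈ =
    P , end , bounded-++ b r U (replicate d 0) P bounded

  -- The prefix has length `lookup k i`, so the next step in direction `i` would read the first
  -- entry of the suffix, which is at least the bound.
  decomposed-Stuck : ∀ k {b r} → b ∈ reaching x U k → r ∈ ending k → Stuck (zipWith _++_ b r) U m k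
  decomposed-Stuck k {b} {r} b∈ r∈ i k<m (v , at , v<u)
    with b∈I , _ ← ∈-reaching⁻ x U k b∈
    with j , _ , sortedIn _ _ ≥u _ ← ∈-ending⁻ k r∈ i
    with lookup r i | ≥u | at-length (lookup b i)
      (subst₂ (_at_≡ v) (Vecₚ.lookup-zipWith _++_ i b r) (sym (proj₁ (b∈I i))) at)
  ... | _ ∷ _ | u≤v ∷ _ | refl = ℕₚ.<⇒≱ v<u u≤v

  -- The tuple is cut at the end `s` of its greedy walk. The same walk shows that the prefix reaches
  -- `s`, and being stuck at `s` puts the suffix in the upper interval.
  InI-decomposes : ∀ a → InI x m a → ∃[ k ] (k ⪯ m × a ∈ decomposed k)
  InI-decomposes a a∈I with P , s⪯m , bounded , stuck ← maximal-path a U m = s , s⪯m ,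
    subst (_∈ decomposed s) glue
      (∈ₚ.∈-cartesianProductWith⁺ (zipWith _++_)
        (∈-reaching⁺ x s (zipWith take s a) (⪯-trans s m n s⪯m m⪯n) prefix∈I
          (P , refl , bounded-take a U s (replicate d 0) P (⪯-refl s) bounded))
        (∈-vectors⁺ (tails (U s) (Z s) s m) (zipWith drop s a) suffix∈))
    where
    s = endpoint (replicate d 0) P

    glue : zipWith _++_ (zipWith take s a) (zipWith drop s a) ≡ a
    glue = lookup-ext (λ i → trans (Vecₚ.lookup-zipWith _++_ i (zipWith take s a) (zipWith drop s a))
      (trans (cong₂ _++_ (Vecₚ.lookup-zipWith take i s a) (Vecₚ.lookup-zipWith drop i s a))
             (Listₚ.take++drop≡id (lookup s i) (lookup a i))))

    prefix∈I : InI x s (zipWith take s a)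
    prefix∈I i with len , sorted , <x ← a∈I i rewrite Vecₚ.lookup-zipWith take i s a =
      trans (Listₚ.length-take (lookup s i) (lookup a i)) (ℕₚ.m≤n⇒m⊓n≡m (subst (lookup s i ≤_) (sym len) (s⪯m i))) ,
      AllPairs⇒Linked (AllPairsₚ.take⁺ (lookup s i) (Linked⇒AllPairs ℕₚ.≤-trans sorted)) ,
      Allₚ.take⁺ (lookup s i) <x

    suffix∈ : ∀ i → lookup (zipWith drop s a) i ∈ lookup (tails (U s) (Z s) s m) i
    suffix∈ i with len , sorted , <x ← a∈I i
      rewrite Vecₚ.lookup-zipWith drop i s a | lookup-tails (U s) (Z s) s m i =
      subst (λ t → drop (lookup s i) (lookup a i) ∈ suffixes (lookup (U s) i) (lookup (Z s) i) (lookup s i) t)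
        (ℕₚ.m+[n∸m]≡n (s⪯m i))
        (∈-suffixes⁺ (lookup (U s) i) (lookup (Z s) i) (lookup s i) (lookup m i ℕ.∸ lookup s i) (sortedIn
          drop-len drop-sorted (≥u _ refl drop-sorted)
          (subst (λ y → All (_< y) (drop (lookup s i) (lookup a i))) (sym (U+Z s (⪯-trans s m n s⪯m m⪯n) i))
            (Allₚ.drop⁺ (lookup s i) <x))))
      where
      drop-len : length (drop (lookup s i) (lookup a i)) ≡ lookup m i ℕ.∸ lookup s i
      drop-len = trans (Listₚ.length-drop (lookup s i) (lookup a i)) (cong (ℕ._∸ lookup s i) len)
      drop-sorted = AllPairsₚ.drop⁺ (lookup s i) (Linked⇒AllPairs ℕₚ.≤-trans sorted)
      -- The suffix is named `r` to expose its first entry. That entry is not below the bound since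
      -- `s` is stuck, and sortedness carries this to the others.
      ≥u : ∀ r → r ≡ drop (lookup s i) (lookup a i) → AllPairs _≤_ r → All (lookup (U s) i ≤_) r
      ≥u []      _  _        = []
      ≥u (v ∷ r) eq (v≤ ∷ _) = u≤v ∷ All.map (ℕₚ.≤-trans u≤v) v≤
        where
        -- A nonempty suffix means that direction `i` is not exhausted, so stuckness applies.
        s<m : lookup s i < lookup m i
        s<m = ℕₚ.m∸n≢0⇒n<m (λ 0≡ → ℕₚ.1+n≢0 (trans (cong length eq) (trans drop-len 0≡)))
        u≤v : lookup (U s) i ≤ v
        u≤v = ℕₚ.≮⇒≥ (λ v<u → stuck i s<m (v , sym (cong List.head eq) , v<u))

  -- All prefixes have the lengths given by `k`, so a glued tuple determines both of its parts.
  decomposed-unique : ∀ k → Unique (decomposed k)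
  decomposed-unique k = cartesianProductWith-unique (zipWith _++_) (reaching x U k) (ending k) injective
    (reaching-unique x U k)
    (vectors-unique (tails (U k) (Z k) k m) (λ i → subst Unique (sym (lookup-tails (U k) (Z k) k m i))
      (suffixes-unique (lookup (U k) i) (lookup (Z k) i) (lookup k i) (lookup m i))))
    where
    injective : ∀ {b b′ r r′} → b ∈ reaching x U k → b′ ∈ reaching x U k → r ∈ ending k → r′ ∈ ending k →
                zipWith _++_ b r ≡ zipWith _++_ b′ r′ → b ≡ b′ × r ≡ r′
    injective {b} {b′} {r} {r′} b∈ b′∈ _ _ eq = lookup-ext (proj₁ ∘ split) , lookup-ext (proj₂ ∘ split)
      where
      split : ∀ i → lookup b i ≡ lookup b′ i × lookup r i ≡ lookup r′ i
      split i = ++-cancel (lookup b i) (lookup b′ i)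
        (trans (proj₁ (proj₁ (∈-reaching⁻ x U k b∈) i)) (sym (proj₁ (proj₁ (∈-reaching⁻ x U k b′∈) i))))
        (trans (sym (Vecₚ.lookup-zipWith _++_ i b r)) (trans (cong (λ v → lookup v i) eq) (Vecₚ.lookup-zipWith _++_ i b′ r′)))

  -- A common tuple would have both `k` and `k′` as reachable stuck points.
  decomposed-disjoint : ∀ {k k′} → k ≢ k′ → Disjoint (decomposed k) (decomposed k′)
  decomposed-disjoint {k} {k′} k≢k′ (a∈ , a∈′)
    with ∈ₚ.∈-cartesianProductWith⁻ (zipWith _++_) (reaching x U k) (ending k) a∈
       | ∈ₚ.∈-cartesianProductWith⁻ (zipWith _++_) (reaching x U k′) (ending k′) a∈′
  ... | b , r , b∈ , r∈ , refl | b′ , r′ , b′∈ , r′∈ , eq = k≢k′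
    (stuck-unique _ m k k′ m⪯n (ending⇒⪯ k r∈) (ending⇒⪯ k′ r′∈)
      (decomposed-Stuck k b∈ r∈) (subst (λ a → Stuck a U m k′) (sym eq) (decomposed-Stuck k′ b′∈ r′∈))
      (decomposed-Reaches k b∈) (subst (λ a → Reaches a U k′) (sym eq) (decomposed-Reaches k′ b′∈)))

  length-tuples : length (tuples x m) ≡ length (concatMap decomposed (box n))
  length-tuples = length-cong (tuples-unique x m)
    (Uniqueₚ.concat⁺ (Allₚ.map⁺ (All.universal decomposed-unique (box n)))
                     (AllPairsₚ.map⁺ (AllPairs.map decomposed-disjoint (box-unique n))))
    (λ a → mk⇔
      (λ a∈ → let k , k⪯m , a∈k = InI-decomposes a (∈-tuples⁻ x m a∈) in
              ∈ₚ.∈-concatMap⁺ decomposed {xs = box n} (lose (∈-box⁺ k n (⪯-trans k m n k⪯m m⪯n)) a∈k))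
      (λ a∈ → let k , _ , a∈k = find (∈ₚ.∈-concatMap⁻ decomposed {xs = box n} a∈)
                  b , r , b∈ , r∈ , eq = ∈ₚ.∈-cartesianProductWith⁻ (zipWith _++_) (reaching x U k) (ending k) a∈k in
              subst (_∈ tuples x m) (sym eq) (∈-tuples⁺ x m _ (decomposed-InI k b∈ r∈))))

-- Expansion of polynomials at the nodes

-- The two cases of `sortedLists` add up by `rising-Δ` at `suc w`, which is Pascal's rule. The empty
-- interval corresponds to `rising-0`.
length-sortedLists : ∀ lo w m → ℕ→ℚ (length (sortedLists lo w m)) ≡ rising m (ℕ→ℚ w)
length-sortedLists lo w       zero    = refl
length-sortedLists lo zero    (suc m) = sym (rising-0 m)
length-sortedLists lo (suc w) (suc m) = begin
  ℕ→ℚ (length (List.map (lo ∷_) (sortedLists lo (suc w) m) ++ sortedLists (suc lo) w (suc m)))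
    ≡⟨ cong ℕ→ℚ (Listₚ.length-++ (List.map (lo ∷_) (sortedLists lo (suc w) m))) ⟩
  ℕ→ℚ (length (List.map (lo ∷_) (sortedLists lo (suc w) m)) ℕ.+ length (sortedLists (suc lo) w (suc m)))
    ≡⟨ ℕ→ℚ-+ (length (List.map (lo ∷_) (sortedLists lo (suc w) m))) (length (sortedLists (suc lo) w (suc m))) ⟩
  ℕ→ℚ (length (List.map (lo ∷_) (sortedLists lo (suc w) m))) + ℕ→ℚ (length (sortedLists (suc lo) w (suc m)))
    ≡⟨ cong₂ _+_ (trans (cong ℕ→ℚ (Listₚ.length-map (lo ∷_) (sortedLists lo (suc w) m))) (length-sortedLists lo (suc w) m))
                 (length-sortedLists (suc lo) w (suc m)) ⟩
  rising m (ℕ→ℚ (suc w)) + rising (suc m) (ℕ→ℚ w)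
    ≡⟨ cong₂ _+_ (sym (rising-Δ m (ℕ→ℚ (suc w)))) (cong (rising (suc m)) w≡) ⟩
  rising (suc m) (ℕ→ℚ (suc w)) - rising (suc m) (ℕ→ℚ (suc w) - 1ℚ) + rising (suc m) (ℕ→ℚ (suc w) - 1ℚ)
    ≡⟨ solve 2 (λ a b → a :- b :+ b := a) refl (rising (suc m) (ℕ→ℚ (suc w))) (rising (suc m) (ℕ→ℚ (suc w) - 1ℚ)) ⟩
  rising (suc m) (ℕ→ℚ (suc w)) ∎
  where
  w≡ : ℕ→ℚ w ≡ ℕ→ℚ (suc w) - 1ℚ
  w≡ = trans (solve 1 (λ t → t := con 1ℚ :+ t :- con 1ℚ) refl (ℕ→ℚ w)) (cong (_- 1ℚ) (sym (ℕ→ℚ-suc w)))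

length-suffixes : ∀ lo w k m → ℕ→ℚ (length (suffixes lo w k m)) ≡ risingΔ k m (ℕ→ℚ w)
length-suffixes lo w zero    m       = length-sortedLists lo w m
length-suffixes lo w (suc k) zero    = refl
length-suffixes lo w (suc k) (suc m) = length-suffixes lo w k m

length-vectors-∷ : ∀ {A : Set} (l : List A) (ls : Vec (List A) d) →
                   ℕ→ℚ (length (vectors (l ∷ ls))) ≡ ℕ→ℚ (length l) * ℕ→ℚ (length (vectors ls))
length-vectors-∷ l ls = trans (cong ℕ→ℚ (length-cartesianProductWith _∷_ l (vectors ls)))
                              (ℕ→ℚ-* (length l) (length (vectors ls)))

length-tuples-rising : ∀ (x m : Vec ℕ d) → ℕ→ℚ (length (tuples x m)) ≡ tensor rising m (Vec.map ℕ→ℚ x)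
length-tuples-rising []       []       = refl
length-tuples-rising (x ∷ xs) (m ∷ ms) = trans
  (length-vectors-∷ (sortedLists 0 x m) (zipWith (sortedLists 0) xs ms))
  (cong₂ _*_ (length-sortedLists 0 x m) (length-tuples-rising xs ms))

length-tails : ∀ (u z k m : Vec ℕ d) → ℕ→ℚ (length (vectors (tails u z k m))) ≡ tensorΔ k m (Vec.map ℕ→ℚ z)
length-tails []       []       []       []       = refl
length-tails (u ∷ us) (z ∷ zs) (k ∷ ks) (m ∷ ms) = trans
  (length-vectors-∷ (suffixes u z k m) (tails us zs ks ms))
  (cong₂ _*_ (length-suffixes u z k m) (length-tails us zs ks ms))

length-concatMap : ∀ {A B : Set} (f : A → List B) L →
                   ℕ→ℚ (length (concatMap f L)) ≡ sumℚ (List.map (λ a → ℕ→ℚ (length (f a))) L)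
length-concatMap f []      = refl
length-concatMap f (a ∷ L) = trans (cong ℕ→ℚ (Listₚ.length-++ (f a)))
  (trans (ℕ→ℚ-+ (length (f a)) (length (concatMap f L))) (cong (ℕ→ℚ (length (f a)) +_) (length-concatMap f L)))

module _ (x n : Vec ℕ d) (Z : Vec ℕ d → Vec ℕ d)
         (Z<x : ∀ k → k ⪯ n → ∀ i → lookup (Z k) i < lookup x i)
         (Z-anti : ∀ k k′ → k ⪯ k′ → k′ ⪯ n → ∀ i → lookup (Z k′) i ≤ lookup (Z k) i)
         where

  private
    F : Vec ℕ d → ℚ
    F k = ℕ→ℚ (length (reaching x (Uof x Z) k))

  -- Double counting of `tuples x m`: in closed form, and by the stuck point `k`, where suffixes and
  -- prefixes contribute one factor each.
  rising-expansion : ∀ m → m ⪯ n →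
    tensor rising m (Vec.map ℕ→ℚ x) ≡ sumℚ (List.map (λ k → tensorΔ k m (Zℚ Z k) * F k) (box n))
  rising-expansion m m⪯n = begin
    tensor rising m (Vec.map ℕ→ℚ x)
      ≡⟨ length-tuples-rising x m ⟨
    ℕ→ℚ (length (tuples x m))
      ≡⟨ cong ℕ→ℚ length-tuples ⟩
    ℕ→ℚ (length (concatMap decomposed (box n)))
      ≡⟨ length-concatMap decomposed (box n) ⟩
    sumℚ (List.map (λ k → ℕ→ℚ (length (decomposed k))) (box n))
      ≡⟨ cong sumℚ (Listₚ.map-cong count (box n)) ⟩
    sumℚ (List.map (λ k → tensorΔ k m (Zℚ Z k) * F k) (box n)) ∎
    where
    open Decomposition x n Z Z<x Z-anti m m⪯n
    count : ∀ k → ℕ→ℚ (length (decomposed k)) ≡ tensorΔ k m (Zℚ Z k) * F k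
    count k = begin
      ℕ→ℚ (length (decomposed k))
        ≡⟨ cong ℕ→ℚ (length-cartesianProductWith (zipWith _++_) (reaching x (Uof x Z) k) (ending k)) ⟩
      ℕ→ℚ (length (reaching x (Uof x Z) k) ℕ.* length (ending k))
        ≡⟨ ℕ→ℚ-* (length (reaching x (Uof x Z) k)) (length (ending k)) ⟩
      F k * ℕ→ℚ (length (ending k))
        ≡⟨ cong (F k *_) (length-tails (Uof x Z k) (Z k) k m) ⟩
      F k * tensorΔ k m (Zℚ Z k)
        ≡⟨ ℚₚ.*-comm (F k) (tensorΔ k m (Zℚ Z k)) ⟩
      tensorΔ k m (Zℚ Z k) * F k ∎

  -- Both sides are linear in `f`, so induction on the derivation reduces the claim to the products
  -- `tensor rising m`.
  expansion : ∀ {f} → Span (_⪯ n) (tensor rising) f →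
              f (Vec.map ℕ→ℚ x) ≡ sumℚ (List.map (λ k → Δmulti k f (Zℚ Z k) * F k) (box n))
  expansion {f} (null f≗0) = trans (f≗0 (Vec.map ℕ→ℚ x)) (sym (zeros (box n)))
    where
    zeros : ∀ L → sumℚ (List.map (λ k → Δmulti k f (Zℚ Z k) * F k) L) ≡ 0ℚ
    zeros []      = refl
    zeros (k ∷ L) = trans (cong₂ _+_ (trans (cong (_* F k) (Δmulti-0 k f≗0 (Zℚ Z k))) (ℚₚ.*-zeroˡ (F k))) (zeros L)) refl
  expansion {f} (gen {m} m⪯n f≗B) = begin
    f (Vec.map ℕ→ℚ x)               ≡⟨ f≗B (Vec.map ℕ→ℚ x) ⟩
    tensor rising m (Vec.map ℕ→ℚ x) ≡⟨ rising-expansion m m⪯n ⟩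
    sumℚ (List.map (λ k → tensorΔ k m (Zℚ Z k) * F k) (box n))
      ≡⟨ cong sumℚ (Listₚ.map-cong (λ k → cong (_* F k)
           (trans (sym (Δmulti-rising k m (Zℚ Z k))) (sym (Δmulti-cong k f≗B (Zℚ Z k))))) (box n)) ⟩
    sumℚ (List.map (λ k → Δmulti k f (Zℚ Z k) * F k) (box n)) ∎
  expansion {h} (lin {f} {g} c s t h≗) = begin
    h (Vec.map ℕ→ℚ x)
      ≡⟨ h≗ (Vec.map ℕ→ℚ x) ⟩
    f (Vec.map ℕ→ℚ x) + c * g (Vec.map ℕ→ℚ x)
      ≡⟨ cong₂ (λ p q → p + c * q) (expansion s) (expansion t) ⟩
    sumℚ (List.map (λ k → Δmulti k f (Zℚ Z k) * F k) (box n)) + c * sumℚ (List.map (λ k → Δmulti k g (Zℚ Z k) * F k) (box n))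
      ≡⟨ sums (box n) ⟨
    sumℚ (List.map (λ k → Δmulti k h (Zℚ Z k) * F k) (box n)) ∎
    where
    sums : ∀ L → sumℚ (List.map (λ k → Δmulti k h (Zℚ Z k) * F k) L)
               ≡ sumℚ (List.map (λ k → Δmulti k f (Zℚ Z k) * F k) L) + c * sumℚ (List.map (λ k → Δmulti k g (Zℚ Z k) * F k) L)
    sums []      = sym (trans (ℚₚ.+-identityˡ (c * 0ℚ)) (ℚₚ.*-zeroʳ c))
    sums (k ∷ L) = trans (cong₂ (λ p q → p * F k + q) (Δmulti-+* k c {f} {g} h≗ (Zℚ Z k)) (sums L))
      (solve 6 (λ a c b p s t → (a :+ c :* b) :* p :+ (s :+ c :* t) := (a :* p :+ s) :+ c :* (b :* p :+ t)) refl
        (Δmulti k f (Zℚ Z k)) c (Δmulti k g (Zℚ Z k)) (F k)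
        (sumℚ (List.map (λ k → Δmulti k f (Zℚ Z k) * F k) L)) (sumℚ (List.map (λ k → Δmulti k g (Zℚ Z k) * F k) L)))

  -- Stated for functions in the span rather than for coefficients, so that it also applies to a
  -- translated polynomial. All terms except that of `n` vanish.
  expansion-δ : ∀ {f} → Span (_⪯ n) (tensor rising) f → ∀ a →
                (∀ k → k ⪯ n → (k ≡ n → Δmulti k f (Zℚ Z k) ≡ a) × (¬ k ≡ n → Δmulti k f (Zℚ Z k) ≡ 0ℚ)) →
                a * F n ≡ f (Vec.map ℕ→ℚ x)
  expansion-δ {f} f∈ a conditions = begin
    a * F n
      ≡⟨ cong (_* F n) (proj₁ (conditions n (⪯-refl n)) refl) ⟨
    Δmulti n f (Zℚ Z n) * F n
      ≡⟨ sum-single (λ k → Δmulti k f (Zℚ Z k) * F k) (box-unique n) (∈-box⁺ n n (⪯-refl n))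
           (λ k k∈ k≢n → trans (cong (_* F k) (proj₂ (conditions k (∈-box⁻ n k∈)) k≢n)) (ℚₚ.*-zeroˡ (F k))) ⟨
    sumℚ (List.map (λ k → Δmulti k f (Zℚ Z k) * F k) (box n))
      ≡⟨ expansion f∈ ⟨
    f (Vec.map ℕ→ℚ x) ∎

-- Existence of Gončarov polynomials and translation of the nodes

zipWith-0 : ∀ (y : Vec ℚ d) → zipWith _-_ y (replicate d 0ℚ) ≡ y
zipWith-0 []       = refl
zipWith-0 (y ∷ ys) = cong₂ _∷_ (solve 1 (λ t → t :- con 0ℚ := t) refl y) (zipWith-0 ys)

zipWith-self : ∀ (y : Vec ℚ d) → zipWith _-_ y y ≡ replicate d 0ℚ
zipWith-self []       = refl
zipWith-self (y ∷ ys) = cong₂ _∷_ (ℚₚ.+-inverseʳ y) (zipWith-self ys)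

-- Used with `s` zero for the nodes `Z`, and with `s` equal to `x` for the nodes `-U`.
span-evalPoly-shift : ∀ (n : Vec ℕ d) c s → Span (_⪯ n) (tensor rising) (λ y → evalPoly n c (zipWith _-_ y s))
span-evalPoly-shift n c s = span-ext
  (span-map (λ _ → 1ℚ) id
    (λ k k⪯n → span-ext (span-tensor pow-rising n k s k⪯n)
      (λ y → trans (ℚₚ.*-identityˡ _) (monomial≡tensor k (zipWith _-_ y s))))
    (span-sum {φ = λ k y → monomial k (zipWith _-_ y s)} c (box n) (All.tabulate (∈-box⁻ n))))
  (λ y → sym (ℚₚ.*-identityˡ _))

-- Each product of rising factorials is re-expanded in monomials, and `span-coefficients` reads off
-- the coefficients on `box n`.
rising-span⇒evalPoly : ∀ (n : Vec ℕ d) {f} → Span (_⪯ n) (tensor rising) f → ∃[ c ] ∀ y → evalPoly n c y ≡ f y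
rising-span⇒evalPoly {d} n {f} f∈ = span-coefficients (Vecₚ.≡-dec ℕ._≟_) (box-unique n) (λ k → ∈-box⁺ k n)
  (span-ext
    (span-map {φ = tensor rising} {ψ = monomial} (λ _ → 1ℚ) id
      (λ k k⪯n → span-map {φ = tensor (λ j t → t ^ℚ j)} (λ _ → 1ℚ) id
        (λ l l⪯n → gen {k = l} l⪯n (λ y → trans (ℚₚ.*-identityˡ _) (sym (monomial≡tensor l y))))
        (span-ext (span-tensor rising-pow n k (replicate d 0ℚ) k⪯n) (λ y → cong (tensor rising k) (sym (zipWith-0 y)))))
      f∈)
    (λ y → sym (ℚₚ.*-identityˡ _)))

goncarov-exists : ∀ (n : Vec ℕ d) W → ∃[ c ] IsDiffGoncarov n W c
goncarov-exists n W
  with f , f∈ , solves ← interpolate n W (δ (Vecₚ.≡-dec ℕ._≟_) n (ℕ→ℚ (vfact n)))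
                           (box n) (All.tabulate (∈-box⁻ n)) (box-ordered n)
  with c , c≗f ← rising-span⇒evalPoly n f∈ = c , λ k k⪯n →
    let Δ≡δ = trans (Δmulti-cong k c≗f (W k)) (solves k (∈-box⁺ k n k⪯n)) in
    (λ k≡n → trans Δ≡δ (δ-≡ (Vecₚ.≡-dec ℕ._≟_) n _ k≡n)) ,
    (λ k≢n → trans Δ≡δ (δ-≢ (Vecₚ.≡-dec ℕ._≟_) n _ k≢n))

ℕ→ℚ-∸ : ∀ {x z} → z ≤ x → ℕ→ℚ z - ℕ→ℚ x ≡ - ℕ→ℚ (x ℕ.∸ z)
ℕ→ℚ-∸ {x} {z} z≤x = begin
  ℕ→ℚ z - ℕ→ℚ x                     ≡⟨ cong (λ t → ℕ→ℚ z - ℕ→ℚ t) (ℕₚ.m∸n+n≡m z≤x) ⟨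
  ℕ→ℚ z - ℕ→ℚ (x ℕ.∸ z ℕ.+ z)       ≡⟨ cong (λ t → ℕ→ℚ z - t) (ℕ→ℚ-+ (x ℕ.∸ z) z) ⟩
  ℕ→ℚ z - (ℕ→ℚ (x ℕ.∸ z) + ℕ→ℚ z)   ≡⟨ solve 2 (λ z u → z :- (u :+ z) := :- u) refl (ℕ→ℚ z) (ℕ→ℚ (x ℕ.∸ z)) ⟩
  - ℕ→ℚ (x ℕ.∸ z) ∎

-- As `z ⪯ x`, the truncated subtraction is exact and z - x = -(x - z).
shifted-nodes : ∀ (x z : Vec ℕ d) → z ⪯ x →
                zipWith _-_ (Vec.map ℕ→ℚ z) (Vec.map ℕ→ℚ x) ≡ Vec.map (-_ ∘ ℕ→ℚ) (zipWith ℕ._∸_ x z)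
shifted-nodes []       []       z⪯x = refl
shifted-nodes (x ∷ xs) (z ∷ zs) z⪯x = cong₂ _∷_ (ℕ→ℚ-∸ (z⪯x zero)) (shifted-nodes xs zs (z⪯x ∘ suc))

theorem15 : (d : ℕ) → 1 ≤ d →
    (x : Vec ℕ d) → (∀ i → 0 < lookup x i) →
    (n : Vec ℕ d) →
    (Z : Vec ℕ d → Vec ℕ d) →
    (∀ k → k ⪯ n → ∀ i → lookup (Z k) i < lookup x i) →
    (∀ k k′ → k ⪯ k′ → k′ ⪯ n → ∀ i → lookup (Z k′) i ≤ lookup (Z k) i) →
    -- existence of the objects involved
    (∃[ L ] Enumerates x n (Uof x Z) L) ×
    (∃[ c ] IsDiffGoncarov n (Zℚ Z) c) ×
    (∃[ c ] IsDiffGoncarov n (negUℚ (Uof x Z)) c) ×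
    -- the identity  n! · |⋃_P 𝓘_n(P;U)| = g̃_n(x;Z) = g̃_n(0;-U)
    (∀ L → Enumerates x n (Uof x Z) L →
     ∀ c → IsDiffGoncarov n (Zℚ Z) c →
     ∀ c′ → IsDiffGoncarov n (negUℚ (Uof x Z)) c′ →
       (ℕ→ℚ (vfact n) * ℕ→ℚ (length L) ≡ evalPoly n c (Data.Vec.map ℕ→ℚ x))
       × (ℕ→ℚ (vfact n) * ℕ→ℚ (length L) ≡ evalPoly n c′ (replicate d (ℕ→ℚ 0))))
theorem15 d 1≤d x 0<x n Z Z<x Z-anti =
  (reaching x U n , enumerates) ,
  goncarov-exists n (Zℚ Z) ,
  goncarov-exists n (negUℚ U) ,
  λ L (uL , L⇔) c c-goncarov c′ c′-goncarov →
    -- Two enumerations without repetitions have the same length, so `L` may be replaced by the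
    -- filtered list.
    let |L| : length L ≡ length (reaching x U n)
        |L| = length-cong uL (proj₁ enumerates) (λ a → mk⇔
          (Equivalence.from (proj₂ enumerates a) ∘ Equivalence.to (L⇔ a))
          (Equivalence.from (L⇔ a) ∘ Equivalence.to (proj₂ enumerates a)))
        count = λ {f} f∈ conditions → trans (cong (λ l → ℕ→ℚ (vfact n) * ℕ→ℚ l) |L|)
          (expansion-δ x n Z Z<x Z-anti {f} f∈ (ℕ→ℚ (vfact n)) conditions)
        -- Translating the argument by `x` turns the conditions at the nodes `-U` into conditions at
        -- the nodes `Z`.
        Δ-shift : ∀ k → k ⪯ n → Δmulti k (λ y → evalPoly n c′ (zipWith _-_ y xℚ)) (Zℚ Z k)
                              ≡ Δmulti k (evalPoly n c′) (negUℚ U k)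
        Δ-shift k k⪯n = trans (Δmulti-shift k xℚ (evalPoly n c′) (Zℚ Z k))
          (cong (Δmulti k (evalPoly n c′)) (shifted-nodes x (Z k) (λ i → ℕₚ.<⇒≤ (Z<x k k⪯n i))))
    in
    count (span-ext (span-evalPoly-shift n c (replicate d 0ℚ)) (λ y → cong (evalPoly n c) (sym (zipWith-0 y)))) c-goncarov ,
    trans
      (count (span-evalPoly-shift n c′ xℚ) (λ k k⪯n →
        (λ k≡n → trans (Δ-shift k k⪯n) (proj₁ (c′-goncarov k k⪯n) k≡n)) ,
        (λ k≢n → trans (Δ-shift k k⪯n) (proj₂ (c′-goncarov k k⪯n) k≢n))))
      -- The translated polynomial at `x` is the original one at the origin.
      (cong (evalPoly n c′) (zipWith-self xℚ))
  where
  U = Uof x Z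
  xℚ = Vec.map ℕ→ℚ x
  enumerates = Monotone.enumerates-reaching n U (Uof-mono x n Z Z-anti) x
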